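{- Let $n\ge 4$. There exists a symmetric shelling order of $\Delta^3_n$, i.e. an ordering of its facets of the form $(F_1,F_2,\dots,F_m,-F_m,-F_{m-1},\dots,-F_1)$ that is a shelling order.
   Context: Simplicial complexes are finite abstract simplicial complexes; $\overline{A}$ is the simplex of all subsets of a finite set $A$. $V_m=\{\pm1,\dots,\pm m\}$; $-\sigma=\{ -v:v\in\sigma\}$, $-\Gamma=\{ -\sigma:\sigma\in\Gamma\}$. The join is $\Gamma*\Gamma'=\{\sigma\cup\tau\}$, $\Gamma*v:=\Gamma*\overline{\{v\}}$; a path/cycle $(v_1,\dots,v_m)$ is the 1-dimensional complex with edges $\{v_j,v_{j+1}\}$. $\partial C^*_m$ is the complex of all subsets of $V_m$ with no pair $\{j,-j\}$. For pure $\Delta$ and pure full-dimensional subcomplex $\Gamma$, $\Delta\setminus\Gamma$ is generated by facets of $\Delta$ not in $\Gamma$; $\partial B$ is the boundary of a combinatorial ball $B$. Recursive definition: $\Delta^1_n=(1,\dots,n,-1,\dots,-n,1)$; $\Delta^d_{d+1}=\partial C^*_{d+1}$; $B^{d,j}_n=\emptyset$ for $j<0$; $B^{1,0}_n=\overline{\{ -1,n\}}$; $B^{2k-1,k}_n=\Delta^{2k-1}_n\setminus B^{2k-1,k-1}_n$ ($k\ge1$, $n\ge 2k$); $B^{d,i}_n=(B^{d-1,i}_{n-1}*n)\cup((-B^{d-1,i-1}_{n-1})*(-n))$ ($d\ge2$, $n\ge d+1$, $i\le\lfloor d/2\rfloor$); $\Delta^d_{n+1}$ is obtained from $\Delta^d_n$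 by replacing $B=B^{d,\lceil d/2\rceil-1}_n$ with $\partial B*(n+1)$ and $-B$ with $\partial(-B)*(-n-1)$ (known to be well defined). An ordering $(G_1,\dots,G_r)$ of the facets of a pure $d$-dimensional complex is a shelling order if for every $2\le t\le r$, $\overline{G_t}\cap\bigcup_{s<t}\overline{G_s}$ is pure of dimension $d-1$. -}

module Defs where

open import Data.Bool using (Bool; true; false; not; if_then_else_)
open import Data.Integer as ℤ using (ℤ; +_)
open import Data.Nat using (ℕ; zero; suc; _*_; _∸_; _≤_; _<ᵇ_; _≡ᵇ_; ⌊_/2⌋)
open import Data.List using (List; []; _∷_; [_]; _++_; map; concatMap; length; filterᵇ; upTo; deduplicate)
open import Data.Bool.ListAction using (any; all)
open import Data.List.Membership.Propositional using (_∈_)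
open import Data.List.Relation.Binary.Subset.Propositional using (_⊆_)
open import Data.List.Relation.Unary.Any using (Any)
open import Data.List.Relation.Unary.All using (All)
open import Data.List.Relation.Unary.AllPairs using (AllPairs)
open import Data.Product using (_×_; ∃)
open import Relation.Nullary using (¬_)
open import Relation.Nullary.Decidable using (⌊_⌋)
open import Relation.Binary.PropositionalEquality using (_≡_; _≢_)

-- Faces are finite lists of integer vertices (read as sets);
-- a complex is given by a list of generating faces (its facets).
-- The empty list of generators is the void complex ∅.

Face : Set
Face = List ℤ

Complex : Set
Complex = List Face

_∈ᵇ_ : ℤ → Face → Bool
x ∈ᵇ σ = any (λ y → ⌊ x ℤ.≟ y ⌋) σ

_⊆ᵇ_ : Face → Face → Bool
σ ⊆ᵇ τ = all (λ x → x ∈ᵇ τ) σ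

negF : Face → Face
negF = map (λ x → ℤ.- x)

negC : Complex → Complex
negC = map negF

joinV : Complex → ℤ → Complex
joinV Γ v = map (v ∷_) Γ

minus : Complex → Complex → Complex
minus Δ Γ = filterᵇ (λ F → not (any (λ G → F ⊆ᵇ G) Γ)) Δ

boundary : Complex → Complex
boundary B =
  concatMap
    (λ F → filterᵇ (λ R → length (filterᵇ (λ G → R ⊆ᵇ G) B) ≡ᵇ 1)
                   (map (λ v → filterᵇ (λ x → not ⌊ x ℤ.≟ v ⌋) F) F))
    B

crossBd : ℕ → Complex
crossBd zero = [ [] ]
crossBd (suc m) =
  concatMap (λ σ → (+ suc m ∷ σ) ∷ (ℤ.- (+ suc m) ∷ σ) ∷ []) (crossBd m)

pathEdges : List ℤ → Complex
pathEdges (x ∷ y ∷ rest) = (x ∷ y ∷ []) ∷ pathEdges (y ∷ rest)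
pathEdges _ = []

cycle1 : ℕ → Complex
cycle1 n = pathEdges (map (λ k → + suc k) (upTo n)
                   ++ map (λ k → ℤ.- (+ suc k)) (upTo n)
                   ++ [ + 1 ])

step : Complex → Complex → ℕ → Complex
step D Bc n = minus D (Bc ++ negC Bc)
           ++ joinV (boundary Bc) (+ suc n)
           ++ joinV (boundary (negC Bc)) (ℤ.- (+ suc n))

-- The recursive families.
--   Del d n      = Δ^d_n           (meaningful for d ≥ 1, n ≥ d+1)
--   Bl d n i     = B^{d,i}_n       (meaningful for 0 ≤ i in range)
--   Bprev d n i  = B^{d,i-1}_n     (∅ when i = 0, i.e. index -1)
--   Bjoin d n i  = (B^{d,i}_n * (n+1)) ∪ ((−B^{d,i-1}_n) * (−(n+1)))
--                = B^{d+1,i}_{n+1} by the join clause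
mutual
  Del : ℕ → ℕ → Complex
  Del zero n = []
  Del (suc zero) n = cycle1 n
  Del (suc (suc d')) zero = []
  Del (suc (suc d')) (suc n) =
    if suc (suc d') <ᵇ n
    then step (Del (suc (suc d')) n) (Bl (suc (suc d')) n ⌊ suc d' /2⌋) n
    else crossBd (suc (suc (suc d')))

  Bl : ℕ → ℕ → ℕ → Complex
  Bl zero n i = []
  Bl (suc zero) n zero = [ ℤ.- (+ 1) ∷ + n ∷ [] ]
  Bl (suc zero) n (suc zero) = minus (Del (suc zero) n) (Bl (suc zero) n zero)
  Bl (suc zero) n (suc (suc i)) = []
  Bl (suc (suc d')) zero i = []
  Bl (suc (suc d')) (suc n) i =
    if (2 * i) ≡ᵇ suc (suc (suc d'))
    then minus (Del (suc (suc d')) (suc n)) (Bjoin (suc d') n (i ∸ 1))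
    else Bjoin (suc d') n i

  Bprev : ℕ → ℕ → ℕ → Complex
  Bprev d n zero = []
  Bprev d n (suc i) = Bl d n i

  Bjoin : ℕ → ℕ → ℕ → Complex
  Bjoin d n i = joinV (Bl d n i) (+ suc n) ++ joinV (negC (Bprev d n i)) (ℤ.- (+ suc n))

card : Face → ℕ
card σ = length (deduplicate ℤ._≟_ σ)

_≋_ : Face → Face → Set
σ ≋ τ = σ ⊆ τ × τ ⊆ σ

IsFace : Complex → Face → Set
IsFace Γ σ = Any (σ ⊆_) Γ

IsFacet : Complex → Face → Set
IsFacet Γ F = IsFace Γ F × (∀ τ → IsFace Γ τ → F ⊆ τ → τ ⊆ F)

IsFacetOrdering : Complex → List Face → Set
IsFacetOrdering Γ L =
  All (IsFacet Γ) L × AllPairs (λ G H → ¬ (G ≋ H)) L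
  × (∀ F → IsFacet Γ F → Any (F ≋_) L)

-- a complex, given by its (downward closed) face predicate P, is pure of
-- dimension k-1, i.e. all its facets have exactly k vertices
IsPureCard : ℕ → (Face → Set) → Set
IsPureCard k P =
  (∀ σ → P σ → card σ ≤ k)
  × (∀ σ → P σ → ∃ λ τ → P τ × σ ⊆ τ × card τ ≡ k)

-- shelling order of a pure d-dimensional complex Γ:
-- for t ≥ 2, closure(G_t) ∩ ⋃_{s<t} closure(G_s) is pure of dimension d-1
IsShellingOrder : ℕ → Complex → List Face → Set
IsShellingOrder d Γ L =
  IsFacetOrdering Γ L
  × (∀ pre G post → L ≡ pre ++ G ∷ post → pre ≢ [] →
       IsPureCard d (λ σ → σ ⊆ G × Any (σ ⊆_) pre))

{-# OPTIONS --safe #-}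

-- Order one half H of the facets and give each facet F a restriction set R(F) such that R(G) ⊈ F and F ∖ R(F) ⊈ G
-- whenever F precedes G in H, and F ∖ R(F) ⊈ −G for all F, G in H. The last condition makes H followed by the
-- reversal of −H satisfy the first two, with R(−F) = −(F ∖ R(F)). They force every ridge to lie in at most two facets;
-- if moreover every ridge lies in two, then for v in R(F) the second facet containing F ∖ v must precede F (it contains
-- F ∖ R(F)), so F meets its predecessors exactly in the ridges F ∖ v with v in R(F), and the order is a shelling.
--
-- The half for n + 1 vertices is B′, C, M, where B′ is the next ball B^{3,1}, M is the half for n without its ball B,
-- and B′ ∪ C is the cone n+1 * ∂B, except that one facet is exchanged for its negative. Removing the apex from a facet of
-- B′ ∪ C leaves a face of B, so all conditions involving M are inherited. The remaining ones concern finitely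
-- many families of facets indexed by i ≤ k = n − 4 and are decided on symbolic vertices a + c with a ∈ {0, i, k}.

module Submission where

open import Defs
open import Data.Bool using (Bool; true; false; not; T; T?; _∧_; _∨_)
open import Data.Bool.ListAction using (any; all)
open import Data.Bool.Properties using (T-∧; T-∨; not-involutive)
open import Data.Empty using (⊥; ⊥-elim)
open import Data.Integer as ℤ using (ℤ; -[1+_]; ∣_∣)
open import Data.Integer.Properties as ℤP using (neg-involutive; neg-injective)
open import Data.List using (List; []; _∷_; [_]; _++_; map; concatMap; length; reverse; filterᵇ; applyUpTo; applyDownFrom; deduplicate)
open import Data.List.Membership.DecPropositional ℤ._≟_ using (_∈?_)
open import Data.List.Membership.Propositional using (_∈_; _∉_; find; lose)
open import Data.List.Membership.Propositional.Properties
open import Data.List.Properties using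
  (∷-injective; concatMap-++; map-++; map-∘; map-cong; map-id; map-applyUpTo;
   map-upTo; reverse-map; unfold-reverse; length-map; filter-reject; filter-all; filter-++; filter-notAll)
open import Data.List.Relation.Binary.Subset.Propositional using (_⊆_)
open import Data.List.Relation.Unary.All as All using (All; []; _∷_)
import Data.List.Relation.Unary.All.Properties as All
open import Data.List.Relation.Unary.AllPairs as AllPairs using (AllPairs; []; _∷_)
import Data.List.Relation.Unary.AllPairs.Properties as AllPairs
open import Data.List.Relation.Unary.Any as Any using (Any; here; there)
import Data.List.Relation.Unary.Any.Properties as Any
open import Data.List.Relation.Unary.Unique.DecPropositional.Properties ℤ._≟_ using (deduplicate-!)
open import Data.List.Relation.Unary.Unique.Propositional using (Unique)
open import Data.Maybe using (Maybe; just; nothing)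
open import Data.Nat as ℕ using (ℕ; zero; suc; _+_; _≤_; _<_; z≤n; s≤s; _<ᵇ_; _≡ᵇ_)
import Data.Nat.Properties as ℕ
open import Data.Product using (∃; ∃₂; _×_; _,_; proj₁; proj₂; map₁; map₂)
open import Data.Sum using (_⊎_; inj₁; inj₂; [_,_]′) renaming (map to map-⊎)
open import Data.Unit using (tt)
open import Function using (_∘_; id; flip; case_of_)
open import Function.Bundles using (Equivalence)
open import Relation.Binary.Definitions using (tri<; tri≈; tri>)
open import Relation.Binary.PropositionalEquality using (_≡_; _≢_; refl; sym; trans; cong; cong₂; subst; subst₂; module ≡-Reasoning)
open import Relation.Nullary using (¬_; yes; no)
open import Relation.Nullary.Decidable using (⌊_⌋; toWitness; fromWitness)

-- Faces as finite sets

-- The ball opens the half because the next step removes exactly B and -B. A facet of M comes after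
-- all of B, so its restriction set lies in no facet of B, hence in no facet erected over a face of
-- B. That triangle and its negative both lie on ∂B, so B and -B share them, and the exchanged facet
-- without -(n+1) is still a face of B. M grows with n, so the second facet through a ridge cannot
-- be found by a finite check. It is obtained by induction, using the order for n: a ridge shared by
-- B and a facet outside B is in no further facet, so it is a triangle of ∂B, and the cone over it
-- replaces the facet lost with B.

_∖_ : Face → ℤ → Face
F ∖ v = filterᵇ (λ x → not ⌊ x ℤ.≟ v ⌋) F

∈-∖⁺ : ∀ {F v x} → x ∈ F → x ≢ v → x ∈ F ∖ v
∈-∖⁺ {F} {v} {x} x∈F x≢v = ∈-filter⁺ (T? ∘ _) x∈F lem
  where
  lem : T (not ⌊ x ℤ.≟ v ⌋)
  lem with x ℤ.≟ v
  ... | yes x≡v = x≢v x≡v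
  ... | no _    = tt

∈-∖⁻ : ∀ {F v x} → x ∈ F ∖ v → x ∈ F × x ≢ v
∈-∖⁻ {F} {v} {x} x∈ with ∈-filter⁻ (T? ∘ (λ x → not ⌊ x ℤ.≟ v ⌋)) {xs = F} x∈
... | x∈F , t = x∈F , lem t
  where
  lem : T (not ⌊ x ℤ.≟ v ⌋) → x ≢ v
  lem t x≡v with x ℤ.≟ v
  ... | no x≢v = x≢v x≡v

length-∖-< : ∀ {F v} → v ∈ F → length (F ∖ v) < length F
length-∖-< {F} {v} v∈F =
  filter-notAll (T? ∘ _) F (Any.map (λ { refl t → lem t }) v∈F)
  where
  lem : ¬ T (not ⌊ v ℤ.≟ v ⌋)
  lem with v ℤ.≟ v
  ... | yes _  = λ ()
  ... | no v≢v = ⊥-elim (v≢v refl)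

Unique-⊆⇒length≤ : ∀ {F G : Face} → Unique F → F ⊆ G → length F ≤ length G
Unique-⊆⇒length≤ {[]} _ _ = z≤n
Unique-⊆⇒length≤ {x ∷ F} (x∉F ∷ uF) F⊆G =
  ℕ.≤-<-trans
    (Unique-⊆⇒length≤ uF (λ y∈F → ∈-∖⁺ (F⊆G (there y∈F)) (All.lookup x∉F y∈F ∘ sym)))
    (length-∖-< (F⊆G (here refl)))

length-∖ : ∀ {F v} → Unique F → v ∈ F → suc (length (F ∖ v)) ≡ length F
length-∖ {F} {v} uF v∈F = ℕ.≤-antisym (length-∖-< v∈F) (Unique-⊆⇒length≤ uF F⊆)
  where
  F⊆ : F ⊆ v ∷ (F ∖ v)
  F⊆ {x} x∈F with x ℤ.≟ v
  ... | yes x≡v = here x≡v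
  ... | no x≢v  = there (∈-∖⁺ x∈F x≢v)

card≤length : ∀ {F G} → F ⊆ G → card F ≤ length G
card≤length {F} F⊆G =
  Unique-⊆⇒length≤ (deduplicate-! F) (F⊆G ∘ ∈-deduplicate⁻ ℤ._≟_ F)

card-∖ : ∀ {F v} → Unique F → v ∈ F → suc (card (F ∖ v)) ≡ length F
card-∖ {F} {v} uF v∈F = ℕ.≤-antisym
  (ℕ.≤-trans (s≤s (card≤length {F ∖ v} id)) (ℕ.≤-reflexive (length-∖ uF v∈F)))
  (Unique-⊆⇒length≤ uF F⊆)
  where
  F⊆ : F ⊆ v ∷ deduplicate ℤ._≟_ (F ∖ v)
  F⊆ {x} x∈F with x ℤ.≟ v
  ... | yes x≡v = here x≡v
  ... | no x≢v  = there (∈-deduplicate⁺ ℤ._≟_ (∈-∖⁺ x∈F x≢v))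

⊆-dec : ∀ F G → F ⊆ G ⊎ ∃ λ x → x ∈ F × x ∉ G
⊆-dec F G with All.all? (_∈? G) F
... | yes F⊆G = inj₁ (All.lookup F⊆G)
... | no F⊈G with find (All.¬All⇒Any¬ (_∈? G) F F⊈G)
...   | x , x∈F , x∉G = inj₂ (x , x∈F , x∉G)

-- `G` lies across the ridge of `F` opposite `v`. Recording only that `G` holds this ridge and
-- avoids `v` lets the relation pass to subsets of `F`.
Adj : ℤ → Face → Face → Set
Adj v F G = v ∉ G × (∀ {x} → x ∈ F → x ≢ v → x ∈ G)

-- By counting: if `G` were inside `F`, it would fit into the ridge and be too small; if two
-- vertices of `G` were outside `F`, the remaining |G| - 2 vertices could not hold the ridge.
Adj-sym : ∀ {v F G} → Unique F → Unique G → length F ≡ length G →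
          v ∈ F → Adj v F G → ∃ λ w → w ∈ G × Adj w G F
Adj-sym {v} {F} {G} uF uG |F|≡|G| v∈F (v∉G , F⊆) with ⊆-dec G F
... | inj₁ G⊆F = ⊥-elim (ℕ.<-irrefl (sym |F|≡|G|)
        (ℕ.≤-<-trans
          (Unique-⊆⇒length≤ uG (λ x∈G → ∈-∖⁺ (G⊆F x∈G) λ { refl → v∉G x∈G }))
          (length-∖-< v∈F)))
... | inj₂ (w , w∈G , w∉F) = w , w∈G , w∉F , inF
  where
  inF : ∀ {x} → x ∈ G → x ≢ w → x ∈ F
  inF {x} x∈G x≢w with x ∈? F
  ... | yes x∈F = x∈F
  ... | no x∉F  = ⊥-elim (ℕ.<-irrefl |F|≡|G| bound)
    where
    open ℕ.≤-Reasoning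
    F∖v⊆ : (F ∖ v) ⊆ ((G ∖ w) ∖ x)
    F∖v⊆ y∈ = let y∈F , y≢v = ∈-∖⁻ {F} y∈ in
      ∈-∖⁺ (∈-∖⁺ (F⊆ y∈F y≢v) λ { refl → w∉F y∈F }) λ { refl → x∉F y∈F }
    uF∖v : Unique (F ∖ v)
    uF∖v = AllPairs.filter⁺ (T? ∘ _) uF
    bound : length F < length G
    bound = begin-strict
      length F                     ≡⟨ length-∖ uF v∈F ⟨
      suc (length (F ∖ v))         ≤⟨ s≤s (Unique-⊆⇒length≤ uF∖v F∖v⊆) ⟩
      suc (length ((G ∖ w) ∖ x))   ≤⟨ length-∖-< (∈-∖⁺ x∈G x≢w) ⟩
      length (G ∖ w)               <⟨ length-∖-< w∈G ⟩
      length G                     ∎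

≋-refl : ∀ {F} → F ≋ F
≋-refl = id , id

≋-sym : ∀ {F G} → F ≋ G → G ≋ F
≋-sym (p , q) = q , p

≋-trans : ∀ {F G H} → F ≋ G → G ≋ H → F ≋ H
≋-trans (p , q) (r , s) = r ∘ p , q ∘ s

≡⇒≋ : ∀ {F G} → F ≡ G → F ≋ G
≡⇒≋ refl = ≋-refl

Adj-resp : ∀ {v F F′ G G′} → F′ ⊆ F → G ≋ G′ → Adj v F G → Adj v F′ G′
Adj-resp F′⊆F (G⊆ , ⊆G) (v∉G , F⊆) = v∉G ∘ ⊆G , λ x∈ x≢v → G⊆ (F⊆ (F′⊆F x∈) x≢v)

∈-neg⁺ : ∀ {x F} → x ∈ F → ℤ.- x ∈ negF F
∈-neg⁺ = ∈-map⁺ (ℤ.-_)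

∈-neg⁻ : ∀ {x F} → x ∈ negF F → ℤ.- x ∈ F
∈-neg⁻ {F = F} x∈ with ∈-map⁻ (ℤ.-_) {xs = F} x∈
... | y , y∈F , refl = subst (_∈ F) (sym (neg-involutive y)) y∈F

∉-neg⁺ : ∀ {x F} → x ∉ F → ℤ.- x ∉ negF F
∉-neg⁺ {x} {F} x∉F p = x∉F (subst (_∈ F) (neg-involutive x) (∈-neg⁻ p))

negF-involutive : ∀ F → negF (negF F) ≡ F
negF-involutive F = trans (sym (map-∘ F)) (trans (map-cong neg-involutive F) (map-id F))

negF-⊆ : ∀ {F G} → F ⊆ G → negF F ⊆ negF G
negF-⊆ {F} {G} F⊆G {x} x∈ = subst (_∈ negF G) (neg-involutive x) (∈-neg⁺ (F⊆G (∈-neg⁻ x∈)))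

negF-≋ : ∀ {F G} → F ≋ G → negF F ≋ negF G
negF-≋ (p , q) = negF-⊆ p , negF-⊆ q

Adj-neg : ∀ {v F G} → Adj v F G → Adj (ℤ.- v) (negF F) (negF G)
Adj-neg {v} {F} {G} (v∉G , F⊆) = ∉-neg⁺ v∉G , inG
  where
  inG : ∀ {x} → x ∈ negF F → x ≢ ℤ.- v → x ∈ negF G
  inG {x} x∈ x≢ = subst (_∈ negF G) (neg-involutive x)
    (∈-neg⁺ (F⊆ (∈-neg⁻ x∈) λ eq → x≢ (trans (sym (neg-involutive x)) (cong ℤ.-_ eq))))

-- Orders of facets with restriction sets

-- A facet of a shelling, in which the vertices of the restriction set carry the tag true:
-- the new faces contributed by the facet are those containing low.
Tagged : Set → Set
Tagged A = List (Bool × A)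

module _ {A : Set} where

  fac low upp : Tagged A → List A
  fac = map proj₂
  low [] = []
  low ((true  , x) ∷ e) = x ∷ low e
  low ((false , x) ∷ e) = low e
  upp [] = []
  upp ((true  , x) ∷ e) = upp e
  upp ((false , x) ∷ e) = x ∷ upp e

  low⊆fac : ∀ e → low e ⊆ fac e
  low⊆fac ((true  , x) ∷ e) (here eq)  = here eq
  low⊆fac ((true  , x) ∷ e) (there x∈) = there (low⊆fac e x∈)
  low⊆fac ((false , x) ∷ e) x∈         = there (low⊆fac e x∈)

  upp⊆fac : ∀ e → upp e ⊆ fac e
  upp⊆fac ((false , x) ∷ e) (here eq)  = here eq
  upp⊆fac ((false , x) ∷ e) (there x∈) = there (upp⊆fac e x∈)
  upp⊆fac ((true  , x) ∷ e) x∈         = there (upp⊆fac e x∈)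

  low⊎upp : ∀ e {x} → x ∈ fac e → x ∈ low e ⊎ x ∈ upp e
  low⊎upp ((true  , x) ∷ e) (here eq)  = inj₁ (here eq)
  low⊎upp ((false , x) ∷ e) (here eq)  = inj₂ (here eq)
  low⊎upp ((true  , x) ∷ e) (there x∈) = map-⊎ there id (low⊎upp e x∈)
  low⊎upp ((false , x) ∷ e) (there x∈) = map-⊎ id there (low⊎upp e x∈)

  low∩upp : ∀ e {x} → Unique (fac e) → x ∈ low e → x ∉ upp e
  low∩upp ((true  , _) ∷ e) (x∉ ∷ _) (here refl) q = All.lookup x∉ (upp⊆fac e q) refl
  low∩upp ((true  , _) ∷ e) (_ ∷ u)  (there p)   q = low∩upp e u p q
  low∩upp ((false , _) ∷ e) (x∉ ∷ _) p (here refl) = All.lookup x∉ (low⊆fac e p) refl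
  low∩upp ((false , _) ∷ e) (_ ∷ u)  p (there q)   = low∩upp e u p q

Facet : Set
Facet = Tagged ℤ

-- The restriction set of −F in the reversed order is the complement of that of F, whence the flipped tags.
negT : Facet → Facet
negT = map (λ (b , x) → not b , ℤ.- x)

negT-involutive : ∀ e → negT (negT e) ≡ e
negT-involutive e = trans (sym (map-∘ e))
  (trans (map-cong (λ (b , x) → cong₂ _,_ (not-involutive b) (neg-involutive x)) e) (map-id e))

fac-neg : ∀ e → fac (negT e) ≡ negF (fac e)
fac-neg e = trans (sym (map-∘ e)) (map-∘ e)

low-neg : ∀ e → low (negT e) ≡ negF (upp e)
low-neg [] = refl
low-neg ((true  , x) ∷ e) = low-neg e
low-neg ((false , x) ∷ e) = cong (_ ∷_) (low-neg e)

upp-neg : ∀ e → upp (negT e) ≡ negF (low e)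
upp-neg [] = refl
upp-neg ((true  , x) ∷ e) = cong (_ ∷_) (upp-neg e)
upp-neg ((false , x) ∷ e) = upp-neg e

Misses : Face → Face → Set
Misses R F = Any (_∉ F) R

Misses⇒⊈ : ∀ {R F} → Misses R F → ¬ (R ⊆ F)
Misses⇒⊈ mis R⊆F = let _ , x∈R , x∉F = find mis in x∉F (R⊆F x∈R)

Misses-antitone : ∀ {R S F} → R ⊆ S → Misses R F → Misses S F
Misses-antitone R⊆S mis = let _ , x∈R , x∉F = find mis in lose (R⊆S x∈R) x∉F

Misses-neg : ∀ {R F} → Misses R F → Misses (negF R) (negF F)
Misses-neg mis = let _ , x∈R , x∉F = find mis in lose (∈-neg⁺ x∈R) (∉-neg⁺ x∉F)

-- The second component is the first one for `negT f` before `negT e`, which makes the relation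
-- invariant under reversal combined with negation.
_≺_ : Facet → Facet → Set
e ≺ f = Misses (low f) (fac e) × Misses (upp e) (fac f)

≺-neg : ∀ {e f} → e ≺ f → negT f ≺ negT e
≺-neg {e} {f} (p , q)
  rewrite low-neg e | fac-neg f | upp-neg f | fac-neg e = Misses-neg q , Misses-neg p

≺⇒⊈ : ∀ {e f} → e ≺ f → ¬ (fac e ⊆ fac f)
≺⇒⊈ {e} (_ , q) = Misses⇒⊈ (Misses-antitone (upp⊆fac e) q)

≺⇒⊉ : ∀ {e f} → e ≺ f → ¬ (fac f ⊆ fac e)
≺⇒⊉ {f = f} (p , _) = Misses⇒⊈ (Misses-antitone (low⊆fac f) p)

Comparable : List Facet → Set
Comparable L = ∀ {e f} → e ∈ L → f ∈ L → e ≡ f ⊎ e ≺ f ⊎ f ≺ e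

comparable : ∀ {L} → AllPairs _≺_ L → Comparable L
comparable (_ ∷ _)   (here refl) (here refl) = inj₁ refl
comparable (e≺ ∷ _)  (here refl) (there f∈)  = inj₂ (inj₁ (All.lookup e≺ f∈))
comparable (f≺ ∷ _)  (there e∈)  (here refl) = inj₂ (inj₂ (All.lookup f≺ e∈))
comparable (_ ∷ ord) (there e∈)  (there f∈)  = comparable ord e∈ f∈

⊆⇒≡ : ∀ {L e f} → Comparable L → e ∈ L → f ∈ L → fac e ⊆ fac f → e ≡ f
⊆⇒≡ cmp e∈ f∈ e⊆f with cmp e∈ f∈
... | inj₁ e≡f = e≡f
... | inj₂ (inj₁ e≺f) = ⊥-elim (≺⇒⊈ e≺f e⊆f)
... | inj₂ (inj₂ f≺e) = ⊥-elim (≺⇒⊉ f≺e e⊆f)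

Tetra : Face → Set
Tetra F = Unique F × length F ≡ 4

-- A facet between two others cannot share the same ridge with both: the removed
-- vertex lies in low or in upp, and then the ridge contains the other part.
between : ∀ {d e f v} → d ≺ e → e ≺ f → Unique (fac e) → v ∈ fac e →
          (∀ {x} → x ∈ fac e → x ≢ v → x ∈ fac d) →
          (∀ {x} → x ∈ fac e → x ≢ v → x ∈ fac f) → ⊥
between {d} {e} {f} (low-d , _) (_ , upp-f) u v∈e ⊆d ⊆f with low⊎upp e v∈e
... | inj₁ v∈low = Misses⇒⊈ upp-f λ x∈ → ⊆f (upp⊆fac e x∈) λ { refl → low∩upp e u v∈low x∈ }
... | inj₂ v∈upp = Misses⇒⊈ low-d λ x∈ → ⊆d (low⊆fac e x∈) λ { refl → low∩upp e u x∈ v∈upp }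

-- Of three pairwise comparable facets, one has a predecessor and a successor among the other two,
-- even if the three form a cycle; `between` excludes that one.
ridge-in-two : ∀ {L e f g v} → Comparable L → (∀ {e} → e ∈ L → Tetra (fac e)) →
               e ∈ L → f ∈ L → g ∈ L → v ∈ fac e →
               Adj v (fac e) (fac f) → Adj v (fac e) (fac g) → f ≡ g
ridge-in-two {L} {e} {f} {g} {v} cmp tet e∈ f∈ g∈ v∈e ef eg
  with cmp e∈ f∈ | cmp e∈ g∈ | cmp f∈ g∈
... | inj₁ refl | _ | _ = ⊥-elim (proj₁ ef v∈e)
... | _ | inj₁ refl | _ = ⊥-elim (proj₁ eg v∈e)
... | _ | _ | inj₁ f≡g = f≡g
... | inj₂ ef? | inj₂ eg? | inj₂ fg? = ⊥-elim (absurd ef? eg? fg?)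
  where
  opposite : ∀ {h} → h ∈ L → Adj v (fac e) (fac h) → ∃ λ w → w ∈ fac h × Adj w (fac h) (fac e)
  opposite h∈ = Adj-sym (proj₁ (tet e∈)) (proj₁ (tet h∈))
                        (trans (proj₂ (tet e∈)) (sym (proj₂ (tet h∈)))) v∈e
  through : ∀ {h h′ w} → Adj w (fac h) (fac e) → Adj v (fac e) (fac h) → Adj v (fac e) (fac h′) →
            ∀ {x} → x ∈ fac h → x ≢ w → x ∈ fac h′
  through he (v∉h , _) (_ , ⊆h′) x∈ x≢ = ⊆h′ (proj₂ he x∈ x≢) λ { refl → v∉h x∈ }
  midE : ∀ {h h′} → h ≺ e → e ≺ h′ → Adj v (fac e) (fac h) → Adj v (fac e) (fac h′) → ⊥
  midE h≺e e≺h′ eh eh′ = between h≺e e≺h′ (proj₁ (tet e∈)) v∈e (proj₂ eh) (proj₂ eh′)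
  mid : ∀ {h h′} → h ∈ L → Adj v (fac e) (fac h) → Adj v (fac e) (fac h′) →
        (e ≺ h × h ≺ h′) ⊎ (h′ ≺ h × h ≺ e) → ⊥
  mid h∈ eh eh′ ord with opposite h∈ eh
  ... | w , w∈h , he with ord
  ...   | inj₁ (e≺h , h≺h′) = between e≺h h≺h′ (proj₁ (tet h∈)) w∈h (proj₂ he) (through he eh eh′)
  ...   | inj₂ (h′≺h , h≺e) = between h′≺h h≺e (proj₁ (tet h∈)) w∈h (through he eh eh′) (proj₂ he)
  absurd : e ≺ f ⊎ f ≺ e → e ≺ g ⊎ g ≺ e → f ≺ g ⊎ g ≺ f → ⊥
  absurd (inj₁ e≺f) (inj₂ g≺e) _          = midE g≺e e≺f eg ef
  absurd (inj₂ f≺e) (inj₁ e≺g) _          = midE f≺e e≺g ef eg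
  absurd (inj₁ e≺f) _          (inj₁ f≺g) = mid f∈ ef eg (inj₁ (e≺f , f≺g))
  absurd (inj₂ f≺e) _          (inj₂ g≺f) = mid f∈ ef eg (inj₂ (g≺f , f≺e))
  absurd _          (inj₁ e≺g) (inj₂ g≺f) = mid g∈ eg ef (inj₁ (e≺g , g≺f))
  absurd _          (inj₂ g≺e) (inj₁ f≺g) = mid g∈ eg ef (inj₂ (f≺g , g≺e))

-- From restriction sets and second facets to a shelling

Closed : List Facet → Set
Closed L = ∀ {e v} → e ∈ L → v ∈ fac e → ∃ λ f → f ∈ L × Adj v (fac e) (fac f)

map-++⁻ : ∀ {A B : Set} (f : A → B) L {xs ys} → map f L ≡ xs ++ ys →
          ∃₂ λ L₁ L₂ → L ≡ L₁ ++ L₂ × map f L₁ ≡ xs × map f L₂ ≡ ys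
map-++⁻ f L {[]} eq = [] , L , refl , refl , eq
map-++⁻ f (e ∷ L) {x ∷ xs} eq with refl , eq′ ← ∷-injective eq with map-++⁻ f L {xs} eq′
... | L₁ , L₂ , refl , refl , refl = e ∷ L₁ , L₂ , refl , refl , refl

AllPairs-split : ∀ {A : Set} {_~_ : A → A → Set} pre {e post} → AllPairs _~_ (pre ++ e ∷ post) →
                 All (_~ e) pre × All (e ~_) post
AllPairs-split [] (e~ ∷ _) = [] , e~
AllPairs-split (d ∷ pre) (d~ ∷ ord) =
  map₁ (All.lookup d~ (∈-++⁺ʳ pre (here refl)) ∷_) (AllPairs-split pre ord)

Represents : List Facet → Complex → Set
Represents L Γ = (∀ {F} → F ∈ Γ → ∃ λ e → e ∈ L × F ≋ fac e)
               × (∀ {e} → e ∈ L → ∃ λ F → F ∈ Γ × F ≋ fac e)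

module _ {L Γ} (ord : AllPairs _≺_ L) (tet : ∀ {e} → e ∈ L → Tetra (fac e))
         (closed : Closed L) (rep : Represents L Γ) where

  private
    cmp : Comparable L
    cmp = comparable ord

    face⇒ : ∀ {σ} → IsFace Γ σ → ∃ λ f → f ∈ L × σ ⊆ fac f
    face⇒ σ-face with find σ-face
    ... | F , F∈ , σ⊆F with proj₁ rep F∈
    ...   | f , f∈ , F⊆f , _ = f , f∈ , F⊆f ∘ σ⊆F

    ⇒face : ∀ {σ f} → f ∈ L → σ ⊆ fac f → IsFace Γ σ
    ⇒face f∈ σ⊆f with proj₂ rep f∈
    ... | F , F∈ , _ , f⊆F = lose F∈ (f⊆F ∘ σ⊆f)

    facets : All (IsFacet Γ) (map fac L)
    facets = All.map⁺ (All.tabulate λ {e} e∈ → ⇒face e∈ id , λ τ τ-face e⊆τ → maximal e∈ τ-face e⊆τ)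
      where
      maximal : ∀ {e τ} → e ∈ L → IsFace Γ τ → fac e ⊆ τ → τ ⊆ fac e
      maximal e∈ τ-face e⊆τ with face⇒ τ-face
      ... | f , f∈ , τ⊆f with ⊆⇒≡ cmp e∈ f∈ (τ⊆f ∘ e⊆τ)
      ...   | refl = τ⊆f

    distinct : AllPairs (λ G H → ¬ (G ≋ H)) (map fac L)
    distinct = AllPairs.map⁺ (AllPairs.map (λ e≺f (e⊆f , _) → ≺⇒⊈ e≺f e⊆f) ord)

    exhaustive : ∀ F → IsFacet Γ F → Any (F ≋_) (map fac L)
    exhaustive F (F-face , F-max) with face⇒ F-face
    ... | f , f∈ , F⊆f = lose (∈-map⁺ fac f∈) (F⊆f , F-max (fac f) (⇒face f∈ id) F⊆f)

    module _ pre {e post} (eq : L ≡ pre ++ e ∷ post) where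
      e∈ : e ∈ L
      e∈ = subst (e ∈_) (sym eq) (∈-++⁺ʳ pre (here refl))

      ≺e : All (_≺ e) pre
      ≺e = proj₁ (AllPairs-split pre (subst (AllPairs _≺_) eq ord))

      e≺ : All (e ≺_) post
      e≺ = proj₂ (AllPairs-split pre (subst (AllPairs _≺_) eq ord))

      u : Unique (fac e)
      u = proj₁ (tet e∈)

      -- The facet across the ridge contains upp e, hence cannot come later.
      earlier : ∀ {v} → v ∈ low e → ∃ λ f → f ∈ pre × (fac e ∖ v) ⊆ fac f
      earlier {v} v∈ with closed e∈ (low⊆fac e v∈)
      ... | f , f∈ , v∉f , ⊆f with ∈-++⁻ pre (subst (f ∈_) eq f∈)
      ...   | inj₁ f∈pre = f , f∈pre , λ x∈ → let x∈e , x≢v = ∈-∖⁻ {fac e} x∈ in ⊆f x∈e x≢v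
      ...   | inj₂ (here refl) = ⊥-elim (v∉f (low⊆fac e v∈))
      ...   | inj₂ (there f∈post) = ⊥-elim (Misses⇒⊈ (proj₂ (All.lookup e≺ f∈post))
                λ x∈ → ⊆f (upp⊆fac e x∈) λ { refl → low∩upp e u v∈ x∈ })

      |e∖v| : ∀ {v} → v ∈ fac e → card (fac e ∖ v) ≡ 3
      |e∖v| v∈ = ℕ.suc-injective (trans (card-∖ u v∈) (proj₂ (tet e∈)))

      pure : IsPureCard 3 (λ σ → σ ⊆ fac e × Any (σ ⊆_) (map fac pre))
      pure = bound , extend
        where
        vertex : ∀ {σ} → σ ⊆ fac e → Any (σ ⊆_) (map fac pre) →
                 ∃ λ v → v ∈ low e × σ ⊆ (fac e ∖ v)
        vertex σ⊆e σ⊆pre with find (Any.map⁻ σ⊆pre)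
        -- The restriction set of `e` is not contained in the earlier `f`, so `σ` omits one of its
        -- vertices.
        ... | f , f∈ , σ⊆f with find (proj₁ (All.lookup ≺e f∈))
        ...   | v , v∈ , v∉f = v , v∈ , λ x∈ → ∈-∖⁺ (σ⊆e x∈) λ { refl → v∉f (σ⊆f x∈) }
        bound : ∀ σ → σ ⊆ fac e × Any (σ ⊆_) (map fac pre) → card σ ≤ 3
        bound σ (σ⊆e , σ⊆pre) with vertex σ⊆e σ⊆pre
        ... | v , v∈ , σ⊆ = ℕ.≤-trans (card≤length σ⊆)
                (ℕ.≤-reflexive (ℕ.suc-injective (trans (length-∖ u (low⊆fac e v∈)) (proj₂ (tet e∈)))))
        extend : ∀ σ → σ ⊆ fac e × Any (σ ⊆_) (map fac pre) →
                 ∃ λ τ → (τ ⊆ fac e × Any (τ ⊆_) (map fac pre)) × σ ⊆ τ × card τ ≡ 3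
        extend σ (σ⊆e , σ⊆pre) with vertex σ⊆e σ⊆pre
        ... | v , v∈ , σ⊆ with earlier v∈
        ...   | f , f∈ , ⊆f = fac e ∖ v
                , ((λ x∈ → proj₁ (∈-∖⁻ {fac e} x∈)) , Any.map⁺ (lose f∈ ⊆f))
                , σ⊆ , |e∖v| (low⊆fac e v∈)

  shelling : IsShellingOrder 3 Γ (map fac L)
  shelling = (facets , distinct , exhaustive) , purity
    where
    purity : ∀ pre G post → map fac L ≡ pre ++ G ∷ post → pre ≢ [] →
             IsPureCard 3 (λ σ → σ ⊆ G × Any (σ ⊆_) pre)
    purity pre G post eq _ with map-++⁻ fac L {pre} eq
    ... | L₁ , [] , _ , _ , ()
    ... | L₁ , e ∷ L₂ , L≡ , refl , refl = pure L₁ L≡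

-- Symbolic vertices and families of facets

p m : ℕ → ℤ
p a = ℤ.+ suc a
m a = -[1+ a ]

-- A symbolic number is a base plus a constant; O stands for 0, I for a running index, K for its upper bound.
data Base : Set where
  O I K : Base

Num : Set
Num = Base × ℕ

val : Base → ℕ → ℕ → ℕ
val O i k = 0
val I i k = i
val K i k = k

num : Num → ℕ → ℕ → ℕ
num (b , c) i k = c + val b i k

data Vertex : Set where
  P N : Base → ℕ → Vertex

at : ℕ → ℕ → Vertex → ℤ
at i k (P b c) = p (num (b , c) i k)
at i k (N b c) = m (num (b , c) i k)

Shape : Set
Shape = Tagged Vertex

inst : Shape → ℕ → ℕ → Facet
inst s i k = map (map₂ (at i k)) s

fac-inst : ∀ s i k → fac (inst s i k) ≡ map (at i k) (fac s)
fac-inst s i k = trans (sym (map-∘ s)) (map-∘ s)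

low-inst : ∀ s i k → low (inst s i k) ≡ map (at i k) (low s)
low-inst [] i k = refl
low-inst ((true  , v) ∷ s) i k = cong (_ ∷_) (low-inst s i k)
low-inst ((false , v) ∷ s) i k = low-inst s i k

upp-inst : ∀ s i k → upp (inst s i k) ≡ map (at i k) (upp s)
upp-inst [] i k = refl
upp-inst ((true  , v) ∷ s) i k = upp-inst s i k
upp-inst ((false , v) ∷ s) i k = cong (_ ∷_) (upp-inst s i k)

_==ᵇ_ : Base → Base → Bool
O ==ᵇ O = true
I ==ᵇ I = true
K ==ᵇ K = true
_ ==ᵇ _ = false

==ᵇ-sound : ∀ a b → T (a ==ᵇ b) → a ≡ b
==ᵇ-sound O O _ = refl
==ᵇ-sound I I _ = refl
==ᵇ-sound K K _ = refl

_==_ : Vertex → Vertex → Bool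
P b c == P b′ c′ = (b ==ᵇ b′) ∧ (c ≡ᵇ c′)
N b c == N b′ c′ = (b ==ᵇ b′) ∧ (c ≡ᵇ c′)
_     == _       = false

∧⁻ : ∀ {x y} → T (x ∧ y) → T x × T y
∧⁻ = Equivalence.to T-∧

∨⁻ : ∀ {x y} → T (x ∨ y) → T x ⊎ T y
∨⁻ = Equivalence.to T-∨

==-sound : ∀ u v → T (u == v) → u ≡ v
==-sound (P b c) (P b′ c′) t with ∧⁻ {b ==ᵇ b′} t
... | b≡ , c≡ = cong₂ P (==ᵇ-sound b b′ b≡) (ℕ.≡ᵇ⇒≡ c c′ c≡)
==-sound (N b c) (N b′ c′) t with ∧⁻ {b ==ᵇ b′} t
... | b≡ , c≡ = cong₂ N (==ᵇ-sound b b′ b≡) (ℕ.≡ᵇ⇒≡ c c′ c≡)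

data Ord : Set where
  less same more : Ord

opp : Ord → Ord
opp less = more
opp same = same
opp more = less

Holds : Ord → ℕ → ℕ → Set
Holds less i j = i < j
Holds same i j = i ≡ j
Holds more i j = j < i

opp-holds : ∀ r {i j} → Holds r i j → Holds (opp r) j i
opp-holds less h = h
opp-holds same h = sym h
opp-holds more h = h

-- gap r b b′ = just g means val b i k + g ≤ val b′ j k whenever Holds r i j and i, j ≤ k.
gap : Ord → Base → Base → Maybe ℕ
gap _  O O = just 0
gap less O I = just 1
gap _  O I = just 0
gap same O K = just 0
gap _  O K = just 1
gap less I I = just 1
gap same I I = just 0
gap less I K = just 1
gap _  I K = just 0
gap _  K K = just 0
gap _  _ _ = nothing

-- The gap from `O` to `K` is 1 when `i` and `j` differ, because two distinct numbers up to k force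
-- k ≥ 1.
gap-sound : ∀ r b b′ {g i j k} → gap r b b′ ≡ just g → Holds r i j → i ≤ k → j ≤ k →
            val b i k + g ≤ val b′ j k
gap-sound less O O refl h _ _ = z≤n
gap-sound same O O refl h _ _ = z≤n
gap-sound more O O refl h _ _ = z≤n
gap-sound less O I refl h _ _ = ℕ.≤-trans (s≤s z≤n) h
gap-sound same O I refl h _ _ = z≤n
gap-sound more O I refl h _ _ = z≤n
gap-sound less O K refl h _ j≤k = ℕ.≤-trans (s≤s z≤n) (ℕ.≤-trans h j≤k)
gap-sound same O K refl h _ _ = z≤n
gap-sound more O K refl h i≤k _ = ℕ.≤-trans (s≤s z≤n) (ℕ.≤-trans h i≤k)
gap-sound less I I {i = i} {j} refl h _ _ = subst (_≤ j) (ℕ.+-comm 1 i) h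
gap-sound same I I {i = i} refl h _ _ = ℕ.≤-reflexive (trans (ℕ.+-identityʳ i) h)
gap-sound less I K {i = i} {k = k} refl h _ j≤k = subst (_≤ k) (ℕ.+-comm 1 i) (ℕ.≤-trans h j≤k)
gap-sound same I K {i = i} refl h i≤k _ = subst (_≤ _) (sym (ℕ.+-identityʳ i)) i≤k
gap-sound more I K {i = i} refl h i≤k _ = subst (_≤ _) (sym (ℕ.+-identityʳ i)) i≤k
gap-sound less K K {k = k} refl h _ _ = ℕ.≤-reflexive (ℕ.+-identityʳ k)
gap-sound same K K {k = k} refl h _ _ = ℕ.≤-reflexive (ℕ.+-identityʳ k)
gap-sound more K K {k = k} refl h _ _ = ℕ.≤-reflexive (ℕ.+-identityʳ k)

below : Ord → Num → Num → Bool
below r (b , c) (b′ , c′) with gap r b b′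
... | just g  = c <ᵇ c′ + g
... | nothing = false

below-sound : ∀ r x y {i j k} → Holds r i j → i ≤ k → j ≤ k → T (below r x y) → num x i k < num y j k
below-sound r (b , c) (b′ , c′) {i} {j} {k} h i≤k j≤k t with gap r b b′ in eq
... | just g = begin-strict
  c + val b i k          <⟨ ℕ.+-monoˡ-< (val b i k) (ℕ.<ᵇ⇒< c (c′ + g) t) ⟩
  c′ + g + val b i k     ≡⟨ ℕ.+-assoc c′ g (val b i k) ⟩
  c′ + (g + val b i k)   ≡⟨ cong (c′ +_) (ℕ.+-comm g (val b i k)) ⟩
  c′ + (val b i k + g)   ≤⟨ ℕ.+-monoʳ-≤ c′ (gap-sound r b b′ eq h i≤k j≤k) ⟩
  c′ + val b′ j k        ∎
  where open ℕ.≤-Reasoning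

separated : Ord → Num → Num → Bool
separated r x y = below r x y ∨ below (opp r) y x

separated-sound : ∀ r x y {i j k} → Holds r i j → i ≤ k → j ≤ k →
                  T (separated r x y) → num x i k ≢ num y j k
separated-sound r x y h i≤k j≤k t eq with ∨⁻ {below r x y} t
... | inj₁ x<y = ℕ.<-irrefl eq (below-sound r x y h i≤k j≤k x<y)
... | inj₂ y<x = ℕ.<-irrefl (sym eq) (below-sound (opp r) y x (opp-holds r h) j≤k i≤k y<x)

apart : Ord → Vertex → Vertex → Bool
apart r (P b c) (P b′ c′) = separated r (b , c) (b′ , c′)
apart r (N b c) (N b′ c′) = separated r (b , c) (b′ , c′)
apart r _       _         = true

apart-sound : ∀ r u v {i j k} → Holds r i j → i ≤ k → j ≤ k → T (apart r u v) → at i k u ≢ at j k v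
apart-sound r (P b c) (P b′ c′) h i≤k j≤k t eq =
  separated-sound r (b , c) (b′ , c′) h i≤k j≤k t (ℕ.suc-injective (ℤP.+-injective eq))
apart-sound r (N b c) (N b′ c′) h i≤k j≤k t eq =
  separated-sound r (b , c) (b′ , c′) h i≤k j≤k t (ℤP.-[1+-injective eq)
apart-sound r (P _ _) (N _ _) h i≤k j≤k t ()
apart-sound r (N _ _) (P _ _) h i≤k j≤k t ()

absent : Ord → Vertex → List Vertex → Bool
absent r u = all (apart r u)

absent-sound : ∀ r u F {i j k} → Holds r i j → i ≤ k → j ≤ k → T (absent r u F) →
               at i k u ∉ map (at j k) F
absent-sound r u F h i≤k j≤k t u∈ with ∈-map⁻ _ {xs = F} u∈
... | v , v∈ , eq = apart-sound r u v h i≤k j≤k (All.lookup (All.all⁺ (apart r u) F t) v∈) eq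

misses : Ord → List Vertex → List Vertex → Bool
misses r R F = any (λ u → absent r u F) R

misses-sound : ∀ r R F {i j k} → Holds r i j → i ≤ k → j ≤ k → T (misses r R F) →
               Misses (map (at i k) R) (map (at j k) F)
misses-sound r R F h i≤k j≤k t =
  Any.map⁺ (Any.map (absent-sound r _ F h i≤k j≤k) (Any.any⁻ (λ u → absent r u F) R t))

_∈ₛ_ : Vertex → List Vertex → Bool
u ∈ₛ F = any (u ==_) F

∈ₛ-sound : ∀ u F {i k} → T (u ∈ₛ F) → at i k u ∈ map (at i k) F
∈ₛ-sound u F {i} {k} t =
  Any.map⁺ (Any.map (λ {v} eq → cong (at i k) (==-sound u v eq)) (Any.any⁻ (u ==_) F t))

_⊆ₛ_ : List Vertex → List Vertex → Bool
F ⊆ₛ G = all (_∈ₛ G) F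

⊆ₛ-sound : ∀ F G {i k} → T (F ⊆ₛ G) → map (at i k) F ⊆ map (at i k) G
⊆ₛ-sound F G t x∈ with ∈-map⁻ _ {xs = F} x∈
... | u , u∈ , refl = ∈ₛ-sound u G (All.lookup (All.all⁺ (_∈ₛ G) F t) u∈)

_≡ₛ_ : List Vertex → List Vertex → Bool
[]      ≡ₛ []      = true
(u ∷ F) ≡ₛ (v ∷ G) = (u == v) ∧ (F ≡ₛ G)
_       ≡ₛ _       = false

≡ₛ-sound : ∀ F G → T (F ≡ₛ G) → F ≡ G
≡ₛ-sound [] [] _ = refl
≡ₛ-sound (u ∷ F) (v ∷ G) t with ∧⁻ {u == v} t
... | u≡v , F≡G = cong₂ _∷_ (==-sound u v u≡v) (≡ₛ-sound F G F≡G)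

adj : Vertex → List Vertex → List Vertex → Bool
adj v F G = absent same v G ∧ all (λ u → (u == v) ∨ (u ∈ₛ G)) F

adj-sound : ∀ v F G {i k} → i ≤ k → T (adj v F G) →
            Adj (at i k v) (map (at i k) F) (map (at i k) G)
adj-sound v F G {i} {k} i≤k t with ∧⁻ {absent same v G} t
... | v∉G , F⊆ = absent-sound same v G refl i≤k i≤k v∉G , inG
  where
  inG : ∀ {x} → x ∈ map (at i k) F → x ≢ at i k v → x ∈ map (at i k) G
  inG x∈ x≢v with ∈-map⁻ _ {xs = F} x∈
  ... | u , u∈ , refl with ∨⁻ {u == v} (All.lookup (All.all⁺ _ F F⊆) u∈)
  ...   | inj₁ u≡v = ⊥-elim (x≢v (cong (at i k) (==-sound u v u≡v)))
  ...   | inj₂ u∈G = ∈ₛ-sound u G u∈G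

-- Reparametrised shapes and enumerated families

substB : Num → Num → Base → Num
substB ι κ O = O , 0
substB ι κ I = ι
substB ι κ K = κ

substV : Num → Num → Vertex → Vertex
substV ι κ (P b c) = let b′ , c′ = substB ι κ b in P b′ (c + c′)
substV ι κ (N b c) = let b′ , c′ = substB ι κ b in N b′ (c + c′)

substS : Num → Num → Shape → Shape
substS ι κ = map (map₂ (substV ι κ))

num-subst : ∀ ι κ b c i k →
            c + proj₂ (substB ι κ b) + val (proj₁ (substB ι κ b)) i k ≡
            num (b , c) (num ι i k) (num κ i k)
num-subst ι κ O c i k = ℕ.+-assoc c 0 0
num-subst ι κ I c i k = ℕ.+-assoc c (proj₂ ι) _
num-subst ι κ K c i k = ℕ.+-assoc c (proj₂ κ) _

at-subst : ∀ ι κ v i k → at i k (substV ι κ v) ≡ at (num ι i k) (num κ i k) v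
at-subst ι κ (P b c) i k = cong p (num-subst ι κ b c i k)
at-subst ι κ (N b c) i k = cong m (num-subst ι κ b c i k)

inst-subst : ∀ ι κ s i k → inst (substS ι κ s) i k ≡ inst s (num ι i k) (num κ i k)
inst-subst ι κ s i k =
  trans (sym (map-∘ s)) (map-cong (λ (b , v) → cong (b ,_) (at-subst ι κ v i k)) s)

indexFreeV : Vertex → Bool
indexFreeV (P b c) = not (b ==ᵇ I)
indexFreeV (N b c) = not (b ==ᵇ I)

at-indexFree : ∀ v {i j k} → T (indexFreeV v) → at i k v ≡ at j k v
at-indexFree (P O c) _ = refl
at-indexFree (P K c) _ = refl
at-indexFree (N O c) _ = refl
at-indexFree (N K c) _ = refl

map-at-indexFree : ∀ F {i j k} → T (all indexFreeV F) → map (at i k) F ≡ map (at j k) F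
map-at-indexFree [] _ = refl
map-at-indexFree (v ∷ F) a with ∧⁻ {indexFreeV v} a
... | x , y = cong₂ _∷_ (at-indexFree v x) (map-at-indexFree F y)

inst-indexFree : ∀ s {i j k} → T (all (indexFreeV ∘ proj₂) s) → inst s i k ≡ inst s j k
inst-indexFree [] _ = refl
inst-indexFree ((b , v) ∷ s) a with ∧⁻ {indexFreeV v} a
... | x , y = cong₂ _∷_ (cong (b ,_) (at-indexFree v x)) (inst-indexFree s y)

data Dir : Set where
  one up down : Dir

Family : Set
Family = Dir × Shape

enum : ℕ → Family → List Facet
enum k (one  , s) = [ inst s 0 k ]
enum k (up   , s) = applyUpTo (λ i → inst s i k) (suc k)
enum k (down , s) = applyDownFrom (λ i → inst s i k) (suc k)

blk : List Family → ℕ → List Facet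
blk fs k = concatMap (enum k) fs

top : Dir → ℕ → ℕ
top one k = 0
top _   k = k

top≤ : ∀ d {i k} → i ≤ top d k → i ≤ k
top≤ one  z≤n = z≤n
top≤ up   i≤k = i≤k
top≤ down i≤k = i≤k

∈-enum⁺ : ∀ d {s i k} → i ≤ top d k → inst s i k ∈ enum k (d , s)
∈-enum⁺ one  z≤n = here refl
∈-enum⁺ up   {s} {k = k} i≤k = ∈-applyUpTo⁺ (λ i → inst s i k) (s≤s i≤k)
∈-enum⁺ down {s} {k = k} i≤k = ∈-applyDownFrom⁺ (λ i → inst s i k) (s≤s i≤k)

∈-enum⁻ : ∀ d {s k e} → e ∈ enum k (d , s) → ∃ λ i → i ≤ top d k × e ≡ inst s i k
∈-enum⁻ one (here refl) = 0 , z≤n , refl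
∈-enum⁻ up   e∈ with ∈-applyUpTo⁻ _ e∈
... | i , s≤s i≤k , eq = i , i≤k , eq
∈-enum⁻ down e∈ with ∈-applyDownFrom⁻ _ e∈
... | i , s≤s i≤k , eq = i , i≤k , eq

∈-blk⁺ : ∀ {fs d s i k} → (d , s) ∈ fs → i ≤ top d k → inst s i k ∈ blk fs k
∈-blk⁺ {d = d} f∈ i≤ = ∈-concatMap⁺ (enum _) (lose f∈ (∈-enum⁺ d i≤))

∈-blk⁻ : ∀ {fs k e} → e ∈ blk fs k →
         ∃ λ ((d , s) : Family) → (d , s) ∈ fs × ∃ λ i → i ≤ top d k × e ≡ inst s i k
∈-blk⁻ {fs} e∈ with find (∈-concatMap⁻ (enum _) {xs = fs} e∈)
... | (d , s) , f∈ , e∈f = (d , s) , f∈ , ∈-enum⁻ d e∈f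

-- Checks over pairs of facets

record PairTest (R : Facet → Facet → Set) : Set where
  field
    test  : Ord → Shape → Shape → Bool
    sound : ∀ r s t {i j k} → Holds r i j → i ≤ k → j ≤ k → T (test r s t) → R (inst s i k) (inst t j k)

module _ {R : Facet → Facet → Set} (𝒯 : PairTest R) where
  open PairTest 𝒯

  testAt : Num → Num → Shape → Shape → Bool
  testAt ι κ s t = test same (substS ι κ s) (substS ι κ t)

  testAt-sound : ∀ ι κ s t {i k} → i ≤ k → T (testAt ι κ s t) →
                 R (inst s (num ι i k) (num κ i k)) (inst t (num ι i k) (num κ i k))
  testAt-sound ι κ s t {i} {k} i≤k a = subst (λ e → R e _) (inst-subst ι κ s i k)
    (subst (R _) (inst-subst ι κ t i k) (sound same (substS ι κ s) (substS ι κ t) refl i≤k i≤k a))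

  -- An index-free s may agree with t for the index 0 or k only, so diagonal splits off that index of t.
  ordered atLow atHigh diagonal always : Shape → Shape → Bool
  ordered s t = test less s t ∧ test same s t ∧ test more s t
  atLow s t   = testAt (O , 0) (K , 0) s t ∧ testAt (I , 1) (K , 1) s t
  atHigh s t  = testAt (K , 0) (K , 0) s t ∧ testAt (I , 0) (K , 1) s t
  diagonal s t = all (indexFreeV ∘ proj₂) s ∧ (atLow s t ∨ atHigh s t)
  always s t  = ordered s t ∨ diagonal s t

  ordered-sound : ∀ s t {i j k} → i ≤ k → j ≤ k → T (ordered s t) → R (inst s i k) (inst t j k)
  ordered-sound s t {i} {j} i≤k j≤k a with ∧⁻ {test less s t} a
  ... | l , eg with ∧⁻ {test same s t} eg
  ...   | e , g with ℕ.<-cmp i j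
  ...     | tri< i<j _ _ = sound less s t i<j i≤k j≤k l
  ...     | tri≈ _ i≡j _ = sound same s t i≡j i≤k j≤k e
  ...     | tri> _ _ j<i = sound more s t j<i i≤k j≤k g

  diagonal-sound : ∀ s t {j k} → j ≤ k → T (atLow s t ∨ atHigh s t) → R (inst s j k) (inst t j k)
  diagonal-sound s t {j} j≤k a with ∨⁻ {atLow s t} a
  diagonal-sound s t {zero} j≤k _ | inj₁ l =
    testAt-sound (O , 0) (K , 0) s t {0} z≤n (proj₁ (∧⁻ {testAt (O , 0) (K , 0) s t} l))
  -- A positive index forces a positive bound, and both are read as one more than fresh parameters;
  -- this is the substitution (`I`, 1), (`K`, 1).
  diagonal-sound s t (s≤s j≤k) _ | inj₁ l =
    testAt-sound (I , 1) (K , 1) s t j≤k (proj₂ (∧⁻ {testAt (O , 0) (K , 0) s t} l))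
  diagonal-sound s t {j} {k} j≤k _ | inj₂ h with ℕ.m≤n⇒m<n∨m≡n j≤k
  ... | inj₁ (s≤s j≤k′) =
    testAt-sound (I , 0) (K , 1) s t j≤k′ (proj₂ (∧⁻ {testAt (K , 0) (K , 0) s t} h))
  ... | inj₂ refl =
    testAt-sound (K , 0) (K , 0) s t {k} ℕ.≤-refl (proj₁ (∧⁻ {testAt (K , 0) (K , 0) s t} h))

  always-sound : ∀ s t {i j k} → i ≤ k → j ≤ k → T (always s t) → R (inst s i k) (inst t j k)
  always-sound s t {i} {j} i≤k j≤k a with ∨⁻ {ordered s t} a
  ... | inj₁ x = ordered-sound s t i≤k j≤k x
  ... | inj₂ y with ∧⁻ {all (indexFreeV ∘ proj₂) s} y
  ...   | free , d = subst (λ e → R e _) (inst-indexFree s free) (diagonal-sound s t j≤k d)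

  across : List Family → List Family → Bool
  across fs gs = all (λ f → all (λ g → always (proj₂ f) (proj₂ g)) gs) fs

  across-sound : ∀ fs gs {k e f} → T (across fs gs) → e ∈ blk fs k → f ∈ blk gs k → R e f
  across-sound fs gs a e∈ f∈ with ∈-blk⁻ {fs} e∈ | ∈-blk⁻ {gs} f∈
  ... | (d , s) , s∈ , i , i≤ , refl | (d′ , t) , t∈ , j , j≤ , refl =
    always-sound s t (top≤ d i≤) (top≤ d′ j≤)
      (All.lookup (All.all⁺ _ gs (All.lookup (All.all⁺ _ fs a) s∈)) t∈)

  within : Family → Bool
  within (one  , s) = true
  within (up   , s) = test less s s
  within (down , s) = test more s s

  within-sound : ∀ f k → T (within f) → AllPairs R (enum k f)
  within-sound (one  , s) k _ = [] ∷ []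
  within-sound (up   , s) k a = AllPairs.applyUpTo⁺₁ _ (suc k) λ { i<j (s≤s j≤k) →
    sound less s s i<j (ℕ.≤-trans (ℕ.<⇒≤ i<j) j≤k) j≤k a }
  within-sound (down , s) k a = AllPairs.applyDownFrom⁺₁ _ (suc k) λ { j<i (s≤s i≤k) →
    sound more s s j<i i≤k (ℕ.≤-trans (ℕ.<⇒≤ j<i) i≤k) a }

  pairwise : List Family → Bool
  pairwise []       = true
  pairwise (f ∷ fs) = within f ∧ across [ f ] fs ∧ pairwise fs

  pairwise-sound : ∀ fs k → T (pairwise fs) → AllPairs R (blk fs k)
  pairwise-sound [] k _ = []
  pairwise-sound (f ∷ fs) k a with ∧⁻ {within f} a
  ... | w , a′ with ∧⁻ {across [ f ] fs} a′
  ...   | c , ps = AllPairs.++⁺ (within-sound f k w) (pairwise-sound fs k ps)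
    (All.tabulate λ e∈ → All.tabulate λ f∈ → across-sound [ f ] fs c (∈-++⁺ˡ e∈) f∈)

-- search looks for a member of the families gs related to inst s i k, after splitting
-- either i = 0 from i > 0 or i = k from i < k; the candidates have index 0, k, i or i ± 1.

record Hit (R : Facet → Facet → Set) : Set where
  field
    test  : Shape → Shape → Bool
    sound : ∀ s t {i k} → i ≤ k → T (test s t) → R (inst s i k) (inst t i k)

module _ {R : Facet → Facet → Set} (ℋ : Hit R) where
  open Hit ℋ

  indices : Dir → List Num → List Num
  indices one js = [ (O , 0) ]
  indices _   js = js

  search′ : List Family → Shape → Num → Num → List Num → Bool
  search′ gs s ι κ js =
    any (λ (d , t) → any (λ j → test (substS ι κ s) (substS j κ t)) (indices d js)) gs

  search′-sound : ∀ gs s ι κ js {i k} → i ≤ k → All (λ j → num j i k ≤ num κ i k) js →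
                  T (search′ gs s ι κ js) →
                  ∃ λ t → t ∈ blk gs (num κ i k) × R (inst s (num ι i k) (num κ i k)) t
  search′-sound gs s ι κ js {i} {k} i≤k js≤ a with find (Any.any⁻ _ gs a)
  ... | (d , t) , t∈ , b with find (Any.any⁻ _ (indices d js) b)
  ...   | j , j∈ , c = inst t (num j i k) (num κ i k) , ∈-blk⁺ t∈ (j≤ d j∈)
        , cong-R (inst-subst ι κ s i k) (inst-subst j κ t i k) (sound _ _ i≤k c)
    where
    cong-R : ∀ {e e′ f f′} → e ≡ e′ → f ≡ f′ → R e f → R e′ f′
    cong-R refl refl r = r
    j≤ : ∀ d → j ∈ indices d js → num j i k ≤ top d (num κ i k)
    j≤ one (here refl) = z≤n
    j≤ up   j∈ = All.lookup js≤ j∈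
    j≤ down j∈ = All.lookup js≤ j∈

  ends inner : List Num
  ends  = (O , 0) ∷ (K , 0) ∷ []
  inner = (O , 0) ∷ (I , 0) ∷ (I , 1) ∷ (K , 1) ∷ []

  fromLow fromHigh search : List Family → Shape → Bool
  fromLow  gs s = search′ gs s (O , 0) (K , 0) ends ∧ search′ gs s (I , 1) (K , 1) inner
  fromHigh gs s = search′ gs s (K , 0) (K , 0) ends ∧ search′ gs s (I , 0) (K , 1) inner
  search   gs s = fromLow gs s ∨ fromHigh gs s

  ends≤ : ∀ {i k} → All (λ j → num j i k ≤ k) ends
  ends≤ = z≤n ∷ ℕ.≤-refl ∷ []

  inner≤ : ∀ {i k} → i ≤ k → All (λ j → num j i k ≤ suc k) inner
  inner≤ i≤k = z≤n ∷ ℕ.m≤n⇒m≤1+n i≤k ∷ s≤s i≤k ∷ ℕ.≤-refl ∷ []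

  search-sound : ∀ gs s {i k} → i ≤ k → T (search gs s) → ∃ λ t → t ∈ blk gs k × R (inst s i k) t
  search-sound gs s i≤k a with ∨⁻ {fromLow gs s} a
  search-sound gs s {zero} {k} _ _ | inj₁ l =
    search′-sound gs s (O , 0) (K , 0) ends {0} {k} z≤n ends≤
      (proj₁ (∧⁻ {search′ gs s (O , 0) (K , 0) ends} l))
  search-sound gs s (s≤s i≤k) _ | inj₁ l =
    search′-sound gs s (I , 1) (K , 1) inner i≤k (inner≤ i≤k)
      (proj₂ (∧⁻ {search′ gs s (O , 0) (K , 0) ends} l))
  search-sound gs s {i} {k} i≤k _ | inj₂ h with ℕ.m≤n⇒m<n∨m≡n i≤k
  ... | inj₁ (s≤s i≤k′) =
    search′-sound gs s (I , 0) (K , 1) inner i≤k′ (inner≤ i≤k′)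
      (proj₂ (∧⁻ {search′ gs s (K , 0) (K , 0) ends} h))
  ... | inj₂ refl =
    search′-sound gs s (K , 0) (K , 0) ends {k} {k} ℕ.≤-refl ends≤
      (proj₁ (∧⁻ {search′ gs s (K , 0) (K , 0) ends} h))

  covers : List Family → List Family → Bool
  covers fs gs = all (λ f → search gs (proj₂ f)) fs

  covers-sound : ∀ fs gs {k e} → T (covers fs gs) → e ∈ blk fs k → ∃ λ t → t ∈ blk gs k × R e t
  covers-sound fs gs a e∈ with ∈-blk⁻ {fs} e∈
  ... | (d , s) , s∈ , i , i≤ , refl =
    search-sound gs s (top≤ d i≤) (All.lookup (All.all⁺ _ fs a) s∈)

-- A shape marked with one of its vertices is encoded by repeating that vertex at the head.
Marked : (ℤ → Facet → Facet → Set) → Facet → Facet → Set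
Marked R []            t = ⊥
Marked R ((_ , v) ∷ e) t = R v e t

module _ {R : ℤ → Facet → Facet → Set} (ℋ : Hit (Marked R))
         (part : ∀ {A} → Tagged A → List A)
         (part-inst : ∀ s i k → part (inst s i k) ≡ map (at i k) (part s)) where

  covers-marked : List Family → List Family → Bool
  covers-marked fs gs = all (λ (_ , s) → all (λ v → search ℋ gs ((false , v) ∷ s)) (part s)) fs

  covers-marked-sound : ∀ fs gs {k e v} → T (covers-marked fs gs) → e ∈ blk fs k → v ∈ part e →
                        ∃ λ t → t ∈ blk gs k × R v e t
  covers-marked-sound fs gs {k} a e∈ v∈ with ∈-blk⁻ {fs} e∈
  ... | (d , s) , s∈ , i , i≤ , refl with ∈-map⁻ _ {xs = part s} (subst (_ ∈_) (part-inst s i k) v∈)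
  ...   | u , u∈ , refl =
    search-sound ℋ gs ((false , u) ∷ s) (top≤ d i≤)
      (All.lookup (All.all⁺ _ (part s) (All.lookup (All.all⁺ _ fs a) s∈)) u∈)

-- Conditions on pairs of facets and their checks

negV : Vertex → Vertex
negV (P b c) = N b c
negV (N b c) = P b c

at-neg : ∀ i k v → at i k (negV v) ≡ ℤ.- at i k v
at-neg i k (P b c) = refl
at-neg i k (N b c) = refl

map-at-neg : ∀ i k F → map (at i k) (map negV F) ≡ negF (map (at i k) F)
map-at-neg i k F = trans (sym (map-∘ F)) (trans (map-cong (at-neg i k) F) (map-∘ F))

≺-test : PairTest _≺_
≺-test = record
  { test  = λ r s t → misses (opp r) (low t) (fac s) ∧ misses r (upp s) (fac t)
  ; sound = sound }
  where
  sound : ∀ r s t {i j k} → Holds r i j → i ≤ k → j ≤ k →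
          T (misses (opp r) (low t) (fac s) ∧ misses r (upp s) (fac t)) → inst s i k ≺ inst t j k
  sound r s t {i} {j} {k} h i≤k j≤k a
    rewrite low-inst t j k | fac-inst s i k | upp-inst s i k | fac-inst t j k
    with ∧⁻ {misses (opp r) (low t) (fac s)} a
  ... | l , u = misses-sound (opp r) (low t) (fac s) (opp-holds r h) j≤k i≤k l
              , misses-sound r (upp s) (fac t) h i≤k j≤k u

Against : Facet → Facet → Set
Against e f = Misses (upp e) (negF (fac f))

against-test : PairTest Against
against-test = record
  { test  = λ r s t → misses r (upp s) (map negV (fac t))
  ; sound = sound }
  where
  sound : ∀ r s t {i j k} → Holds r i j → i ≤ k → j ≤ k →
          T (misses r (upp s) (map negV (fac t))) → Against (inst s i k) (inst t j k)
  sound r s t {i} {j} {k} h i≤k j≤k a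
    rewrite upp-inst s i k | fac-inst t j k | sym (map-at-neg j k (fac t)) =
    misses-sound r (upp s) _ h i≤k j≤k a

⊈-test : PairTest (λ e f → Misses (fac e) (fac f))
⊈-test = record
  { test  = λ r s t → misses r (fac s) (fac t)
  ; sound = sound }
  where
  sound : ∀ r s t {i j k} → Holds r i j → i ≤ k → j ≤ k →
          T (misses r (fac s) (fac t)) → Misses (fac (inst s i k)) (fac (inst t j k))
  sound r s t {i} {j} {k} h i≤k j≤k a rewrite fac-inst s i k | fac-inst t j k =
    misses-sound r (fac s) (fac t) h i≤k j≤k a

-- Equal symbols denote equal faces at two different indices only if they do not involve `I`.
stable : Ord → List Vertex → Bool
stable same F = true
stable _    F = all indexFreeV F

stable-sound : ∀ r F {i j k} → Holds r i j → T (stable r F) → map (at i k) F ≡ map (at j k) F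
stable-sound same F refl _ = refl
stable-sound less F _ a = map-at-indexFree F a
stable-sound more F _ a = map-at-indexFree F a

-- e stands for the ridge low e of the facet fac e
OnlyIn : Facet → Facet → Set
OnlyIn e t = Misses (low e) (fac t) ⊎ fac e ≡ fac t

onlyIn-test : PairTest OnlyIn
onlyIn-test = record { test = test ; sound = sound }
  where
  test : Ord → Shape → Shape → Bool
  test r s t = misses r (low s) (fac t) ∨ ((fac s ≡ₛ fac t) ∧ stable r (fac s))
  sound : ∀ r s t {i j k} → Holds r i j → i ≤ k → j ≤ k →
          T (test r s t) → OnlyIn (inst s i k) (inst t j k)
  sound r s t {i} {j} {k} h i≤k j≤k a
    rewrite low-inst s i k | fac-inst s i k | fac-inst t j k
    with ∨⁻ {misses r (low s) (fac t)} a
  ... | inj₁ x = inj₁ (misses-sound r (low s) (fac t) h i≤k j≤k x)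
  ... | inj₂ y with ∧⁻ {fac s ≡ₛ fac t} y
  ...   | s≡t , st = inj₂ (trans (stable-sound r (fac s) h st)
                                 (cong (map (at j k)) (≡ₛ-sound (fac s) (fac t) s≡t)))

SameFace : Facet → Facet → Set
SameFace e t = fac e ≡ fac t

sameFace-hit : Hit SameFace
sameFace-hit = record
  { test  = λ s t → fac s ≡ₛ fac t
  ; sound = λ s t {i} {k} _ a → trans (fac-inst s i k)
      (trans (cong (map (at i k)) (≡ₛ-sound (fac s) (fac t) a)) (sym (fac-inst t i k))) }

-- The ridge of e opposite v is shared with t, or t marks it as a boundary ridge.
Classified : ℤ → Facet → Facet → Set
Classified v e t = Adj v (fac e) (fac t) ⊎ (fac t ≡ fac e × upp t ≡ [ v ])

classified-hit : Hit (Marked Classified)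
classified-hit = record { test = test ; sound = sound }
  where
  test : Shape → Shape → Bool
  test [] t = false
  test ((_ , v) ∷ s) t = adj v (fac s) (fac t) ∨ ((fac t ≡ₛ fac s) ∧ (upp t ≡ₛ [ v ]))
  sound : ∀ s t {i k} → i ≤ k → T (test s t) → Marked Classified (inst s i k) (inst t i k)
  sound ((_ , v) ∷ s) t {i} {k} i≤k a
    rewrite fac-inst s i k | fac-inst t i k | upp-inst t i k
    with ∨⁻ {adj v (fac s) (fac t)} a
  ... | inj₁ x = inj₁ (adj-sound v (fac s) (fac t) i≤k x)
  ... | inj₂ y with ∧⁻ {fac t ≡ₛ fac s} y
  ...   | t≡s , u≡v = inj₂ (cong (map (at i k)) (≡ₛ-sound (fac t) (fac s) t≡s)
                         , cong (map (at i k)) (≡ₛ-sound (upp t) [ v ] u≡v))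

AdjLow : ℤ → Facet → Facet → Set
AdjLow v e t = Adj v (low e) (low t)

adjLow-hit : Hit (Marked AdjLow)
adjLow-hit = record { test = test ; sound = sound }
  where
  test : Shape → Shape → Bool
  test [] t = false
  test ((_ , v) ∷ s) t = adj v (low s) (low t)
  sound : ∀ s t {i k} → i ≤ k → T (test s t) → Marked AdjLow (inst s i k) (inst t i k)
  sound ((_ , v) ∷ s) t {i} {k} i≤k a rewrite low-inst s i k | low-inst t i k =
    adj-sound v (low s) (low t) i≤k a

Adj± : ℤ → Facet → Facet → Set
Adj± v e t = Adj v (fac e) (fac t) ⊎ Adj v (fac e) (negF (fac t))

adj±-hit : Hit (Marked Adj±)
adj±-hit = record { test = test ; sound = sound }
  where
  test : Shape → Shape → Bool
  test [] t = false
  test ((_ , v) ∷ s) t = adj v (fac s) (fac t) ∨ adj v (fac s) (map negV (fac t))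
  sound : ∀ s t {i k} → i ≤ k → T (test s t) → Marked Adj± (inst s i k) (inst t i k)
  sound ((_ , v) ∷ s) t {i} {k} i≤k a
    rewrite fac-inst s i k | fac-inst t i k | sym (map-at-neg i k (fac t)) =
    map-⊎ (adj-sound v (fac s) (fac t) i≤k) (adj-sound v (fac s) _ i≤k)
          (∨⁻ {adj v (fac s) (fac t)} a)

_≋ₛ_ : List Vertex → List Vertex → Bool
F ≋ₛ G = (F ⊆ₛ G) ∧ (G ⊆ₛ F)

≋ₛ-sound : ∀ F G {i k} → T (F ≋ₛ G) → map (at i k) F ≋ map (at i k) G
≋ₛ-sound F G a = let x , y = ∧⁻ {F ⊆ₛ G} a in ⊆ₛ-sound F G x , ⊆ₛ-sound G F y

_≋±_ : Face → Face → Set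
F ≋± G = F ≋ G ⊎ F ≋ negF G

Cone : ℤ → Facet → Facet → Set
Cone v e t = (v ∷ low e) ≋± fac t

cone-hit : Hit (Marked Cone)
cone-hit = record { test = test ; sound = sound }
  where
  test : Shape → Shape → Bool
  test [] t = false
  test ((_ , v) ∷ s) t = ((v ∷ low s) ≋ₛ fac t) ∨ ((v ∷ low s) ≋ₛ map negV (fac t))
  sound : ∀ s t {i k} → i ≤ k → T (test s t) → Marked Cone (inst s i k) (inst t i k)
  sound ((_ , v) ∷ s) t {i} {k} i≤k a
    rewrite low-inst s i k | fac-inst t i k | sym (map-at-neg i k (fac t)) =
    map-⊎ (≋ₛ-sound (v ∷ low s) (fac t)) (≋ₛ-sound (v ∷ low s) (map negV (fac t)))
          (∨⁻ {(v ∷ low s) ≋ₛ fac t} a)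

IsCone : ℤ → Facet → Facet → Set
IsCone v e t = Cone v t e

isCone-hit : Hit (Marked IsCone)
isCone-hit = record { test = test ; sound = sound }
  where
  test : Shape → Shape → Bool
  test [] t = false
  test (w ∷ s) t = Hit.test cone-hit (w ∷ t) s
  sound : ∀ s t {i k} → i ≤ k → T (test s t) → Marked IsCone (inst s i k) (inst t i k)
  sound (w ∷ s) t = Hit.sound cone-hit (w ∷ t) s

Beneath : ℤ → Facet → Facet → Set
Beneath v e t = ∀ {x} → x ∈ fac e → (x ≡ v ⊎ x ≡ ℤ.- v) ⊎ x ∈ fac t

beneath-hit : Hit (Marked Beneath)
beneath-hit = record { test = test ; sound = sound }
  where
  test : Shape → Shape → Bool
  test [] t = false
  test ((_ , v) ∷ s) t = all (λ u → ((u == v) ∨ (u == negV v)) ∨ (u ∈ₛ fac t)) (fac s)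
  sound : ∀ s t {i k} → i ≤ k → T (test s t) → Marked Beneath (inst s i k) (inst t i k)
  sound ((_ , v) ∷ s) t {i} {k} i≤k a {x} x∈ rewrite fac-inst s i k | fac-inst t i k
    with ∈-map⁻ _ {xs = fac s} x∈
  ... | u , u∈ , refl = map-⊎ (map-⊎ (cong (at i k) ∘ ==-sound u v)
            (λ u≡ → trans (cong (at i k) (==-sound u (negV v) u≡)) (at-neg i k v)) ∘ ∨⁻ {u == v})
          (∈ₛ-sound u (fac t)) (∨⁻ {(u == v) ∨ (u == negV v)} (All.lookup (All.all⁺ _ (fac s) a) u∈))

mark : Vertex → List Family → List Family
mark v = map (map₂ ((false , v) ∷_))

∈-mark : ∀ v {fs k e} → e ∈ blk fs k → (∀ {i} → at i k v ≡ at 0 k v) →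
         ((false , at 0 k v) ∷ e) ∈ blk (mark v fs) k
∈-mark v {fs} {k} e∈ free with ∈-blk⁻ {fs} e∈
... | (d , s) , s∈ , i , i≤ , refl =
  subst (λ x → ((false , x) ∷ inst s i k) ∈ blk (mark v fs) k) (free {i}) (∈-blk⁺ (∈-map⁺ _ s∈) i≤)

blk-All : ∀ {Q : Facet → Set} (test : Shape → Bool) {k} →
          (∀ s {i} → i ≤ k → T (test s) → Q (inst s i k)) →
          ∀ fs → T (all (test ∘ proj₂) fs) → ∀ {e} → e ∈ blk fs k → Q e
blk-All test sound fs a e∈ with ∈-blk⁻ {fs} e∈
... | (d , s) , s∈ , i , i≤ , refl = sound s (top≤ d i≤) (All.lookup (All.all⁺ _ fs a) s∈)

distinctV : List Vertex → Bool
distinctV [] = true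
distinctV (v ∷ F) = absent same v F ∧ distinctV F

distinctV-sound : ∀ F {i k} → i ≤ k → T (distinctV F) → Unique (map (at i k) F)
distinctV-sound [] _ _ = []
distinctV-sound (v ∷ F) i≤k a with ∧⁻ {absent same v F} a
... | v∉F , dF = All.¬Any⇒All¬ _ (absent-sound same v F refl i≤k i≤k v∉F) ∷ distinctV-sound F i≤k dF

tetraₛ : Shape → Bool
tetraₛ s = distinctV (fac s) ∧ (length (fac s) ≡ᵇ 4)

tetra-sound : ∀ {k} s {i} → i ≤ k → T (tetraₛ s) → Tetra (fac (inst s i k))
tetra-sound {k} s {i} i≤k a rewrite fac-inst s i k with ∧⁻ {distinctV (fac s)} a
... | d , l = distinctV-sound (fac s) i≤k d
            , trans (length-map (at i k) (fac s)) (ℕ.≡ᵇ⇒≡ _ 4 l)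

Bounded : ℕ → Facet → Set
Bounded n e = ∀ {x} → x ∈ fac e → ∣ x ∣ ≤ n

number : Vertex → Num
number (P b c) = b , c
number (N b c) = b , c

boundedₛ : ℕ → Shape → Bool
boundedₛ c s = all (λ v → below same (number v) (K , c)) (fac s)

bounded-sound : ∀ c {k} s {i} → i ≤ k → T (boundedₛ c s) → Bounded (c + k) (inst s i k)
bounded-sound c {k} s {i} i≤k a x∈ rewrite fac-inst s i k with ∈-map⁻ _ {xs = fac s} x∈
... | P b d , u∈ , refl = below-sound same (b , d) (K , c) refl i≤k i≤k (All.lookup (All.all⁺ _ (fac s) a) u∈)
... | N b d , u∈ , refl = below-sound same (b , d) (K , c) refl i≤k i≤k (All.lookup (All.all⁺ _ (fac s) a) u∈)

-- The balls, half spheres and their boundary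

o r : ∀ {A : Set} → A → Bool × A
o x = false , x
r x = true , x

T₁ T₂ T₃ T₄ T₅ : Shape
T₁ = o (P K 3) ∷ o (P K 2) ∷ o (P I 0) ∷ r (P I 1) ∷ []
T₂ = o (P K 3) ∷ o (P K 2) ∷ r (N I 0) ∷ o (N I 1) ∷ []
T₃ = o (P K 3) ∷ o (P K 2) ∷ o (N K 1) ∷ o (P O 0) ∷ []
T₄ = o (P K 3) ∷ r (N K 2) ∷ o (P O 0) ∷ o (N K 1) ∷ []
T₅ = r (N K 3) ∷ o (N K 2) ∷ o (P O 0) ∷ o (N K 1) ∷ []

-- The shelling of the ball starts over the edge from -(k+2) to 1 and walks along the path B^{1,1}
-- in both directions, so that every later tetrahedron brings one new vertex; hence the opposite
-- directions of `T₂` and `T₁`. `ballF′` has the same facets in the order in which `Bl` unfolds.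
ballF ballF′ : List Family
ballF  = (one , T₃) ∷ (down , T₂) ∷ (up , T₁) ∷ (one , T₄) ∷ (one , T₅) ∷ []
ballF′ = (up , T₁) ∷ (up , T₂) ∷ (one , T₃) ∷ (one , T₄) ∷ (one , T₅) ∷ []

-- The boundary of the ball has 4k + 12 triangles. The cones over 2k + 7 of them are, up to sign,
-- the facets of the next ball; these are the other 2k + 5.
collarF : List Family
collarF =
  (down , o (P K 4) ∷ r (P K 2) ∷ r (P I 0) ∷ o (P I 1) ∷ []) ∷
  (one  , o (P K 4) ∷ r (N K 3) ∷ o (N K 2) ∷ r (N K 1) ∷ []) ∷
  (one  , o (P K 4) ∷ o (N K 3) ∷ r (P O 0) ∷ r (N K 1) ∷ []) ∷
  (one  , o (P K 4) ∷ r (P K 2) ∷ r (N K 1) ∷ o (P O 0) ∷ []) ∷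
  (down , o (P K 4) ∷ r (P K 2) ∷ r (N I 0) ∷ o (N I 1) ∷ []) ∷ []

-- For n = 4 the sphere has the 16 facets of the cross-polytope. The ball takes one from each of
-- five antipodal pairs, and these are representatives of the other three.
coreF : List Family
coreF =
  (one , o (P O 0) ∷ r (P O 1) ∷ r (N O 2) ∷ o (P O 3) ∷ []) ∷
  (one , o (P O 0) ∷ o (N O 1) ∷ r (P O 2) ∷ r (N O 3) ∷ []) ∷
  (one , o (P O 0) ∷ r (P O 1) ∷ o (P O 2) ∷ r (N O 3) ∷ []) ∷ []

-- Vertices count from 0: ball k is B^{3,1}_{k+4}, with p a and m a standing for ±(a + 1).
ball collar : ℕ → List Facet
ball k   = blk ballF k
collar k = blk collarF k

outer : ℕ → List Facet
outer zero    = blk coreF 0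
outer (suc k) = collar k ++ outer k

half : ℕ → List Facet
half k = ball k ++ outer k

next last : Shape → Shape
next = substS (I , 0) (K , 1)
last = substS (K , 1) (K , 1)

-- The ball for k + 1 rewritten in the parameter k, so that it can be compared with the collar: an
-- index up to k + 1 is either at most k or equal to k + 1.
nextBallF : List Family
nextBallF =
  (one , next T₃) ∷ (one , last T₂) ∷ (down , next T₂) ∷ (up , next T₁) ∷ (one , last T₁) ∷
  (one , next T₄) ∷ (one , next T₅) ∷ []

newF : List Family
newF = nextBallF ++ collarF

drop : ℕ → Shape → Shape
drop n [] = []
drop zero ((_ , v) ∷ s) = o v ∷ map (λ (_ , v) → r v) s
drop (suc n) ((_ , v) ∷ s) = r v ∷ drop n s

-- Each boundary triangle of the ball is given by the tetrahedron containing it, with the removed vertex tagged false.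
rimF : List Family
rimF =
  (up , drop 0 T₁) ∷ (up , drop 1 T₁) ∷ (one , drop 2 (substS (K , 0) (K , 0) T₁)) ∷
  (up , drop 0 T₂) ∷ (up , drop 1 T₂) ∷ (one , drop 3 (substS (O , 0) (K , 0) T₂)) ∷
  (one , drop 0 T₃) ∷ (one , drop 2 T₄) ∷ (one , drop 3 T₄) ∷
  (one , drop 1 T₅) ∷ (one , drop 2 T₅) ∷ (one , drop 3 T₅) ∷ []

rim : ℕ → List Facet
rim k = blk rimF k

-- Facts decided by the symbolic checks, uniformly in k

ball-ordered : ∀ k → AllPairs _≺_ (ball k)
ball-ordered k = pairwise-sound ≺-test ballF k tt

collar-ordered : ∀ k → AllPairs _≺_ (collar k)
collar-ordered k = pairwise-sound ≺-test collarF k tt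

nextBall≺collar : ∀ {k e f} → e ∈ blk nextBallF k → f ∈ collar k → e ≺ f
nextBall≺collar = across-sound ≺-test nextBallF collarF tt

new-against : ∀ {k e f} → e ∈ blk newF k → f ∈ blk newF k → Against e f
new-against = across-sound against-test newF newF tt

new-beneath : ∀ {k e} → e ∈ blk newF k → ∃ λ t → t ∈ ball k × Beneath (p (4 + k)) e t
new-beneath {k} e∈ = covers-sound beneath-hit (mark (P K 4) newF) ballF {k} tt (∈-mark (P K 4) {newF} e∈ refl)

new-cone : ∀ {k e} → e ∈ blk newF k → ∃ λ t → t ∈ rim k × Cone (p (4 + k)) t e
new-cone {k} e∈ = covers-sound isCone-hit (mark (P K 4) newF) rimF {k} tt (∈-mark (P K 4) {newF} e∈ refl)

rim-cone : ∀ {k e} → e ∈ rim k → ∃ λ t → t ∈ blk newF k × Cone (p (4 + k)) e t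
rim-cone {k} e∈ = covers-sound cone-hit (mark (P K 4) rimF) newF {k} tt (∈-mark (P K 4) {rimF} e∈ refl)

rim⇒ball : ∀ {k e} → e ∈ rim k → ∃ λ t → t ∈ ball k × fac e ≡ fac t
rim⇒ball {k} = covers-sound sameFace-hit rimF ballF {k} tt

ball⇒ball′ : ∀ {k e} → e ∈ ball k → ∃ λ t → t ∈ blk ballF′ k × fac e ≡ fac t
ball⇒ball′ {k} = covers-sound sameFace-hit ballF ballF′ {k} tt

ball′⇒ball : ∀ {k e} → e ∈ blk ballF′ k → ∃ λ t → t ∈ ball k × fac e ≡ fac t
ball′⇒ball {k} = covers-sound sameFace-hit ballF′ ballF {k} tt

ball′-distinct : ∀ k → AllPairs (λ e f → Misses (fac e) (fac f)) (blk ballF′ k)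
ball′-distinct k = pairwise-sound ⊈-test ballF′ k tt

-- Every tetrahedron of the ball has a triangle on the boundary, so `rimF` also mentions all of
-- them, and one search in it finds either the facet across a ridge or the boundary ridge itself.
classify : ∀ {k e v} → e ∈ ball k → v ∈ fac e → ∃ λ t → t ∈ rim k × Classified v e t
classify {k} = covers-marked-sound classified-hit fac fac-inst ballF rimF {k} tt

-- The boundary is a closed surface. This supplies the neighbours of a cone facet across the ridges
-- through the apex.
rim-closed : ∀ {k e v} → e ∈ rim k → v ∈ low e → ∃ λ t → t ∈ rim k × Adj v (low e) (low t)
rim-closed {k} = covers-marked-sound adjLow-hit low low-inst rimF rimF {k} tt

rim-only : ∀ {k e t} → e ∈ rim k → t ∈ ball k → OnlyIn e t
rim-only = across-sound onlyIn-test rimF ballF tt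

new-tetra : ∀ {k e} → e ∈ blk newF k → Tetra (fac e)
new-tetra {k} = blk-All tetraₛ tetra-sound newF tt

ball-tetra : ∀ {k e} → e ∈ ball k → Tetra (fac e)
ball-tetra {k} = blk-All tetraₛ tetra-sound ballF tt

ball-bounded : ∀ {k e} → e ∈ ball k → Bounded (4 + k) e
ball-bounded {k} = blk-All (boundedₛ 4) (bounded-sound 4) ballF tt

collar-bounded : ∀ {k e} → e ∈ collar k → Bounded (5 + k) e
collar-bounded {k} = blk-All (boundedₛ 5) (bounded-sound 5) collarF tt

outer-bounded : ∀ k {e} → e ∈ outer k → Bounded (4 + k) e
outer-bounded zero = blk-All {Bounded 4} (boundedₛ 4) (bounded-sound 4 {0}) coreF tt
outer-bounded (suc k) e∈ with ∈-++⁻ (collar k) e∈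
... | inj₁ e∈collar = collar-bounded {k} e∈collar
... | inj₂ e∈outer = ℕ.m≤n⇒m≤1+n ∘ outer-bounded k e∈outer

half-bounded : ∀ k {e} → e ∈ half k → Bounded (4 + k) e
half-bounded k e∈ with ∈-++⁻ (ball k) e∈
... | inj₁ e∈ball = ball-bounded {k} e∈ball
... | inj₂ e∈outer = outer-bounded k e∈outer

-- Separating the new layer from the older facets

apex : ℕ → ℤ
apex k = p (4 + k)

apex∉ : ∀ {k e} → Bounded (4 + k) e → apex k ∉ fac e
apex∉ b x∈ = ℕ.<-irrefl refl (b x∈)

-apex∉ : ∀ {k e} → Bounded (4 + k) e → ℤ.- apex k ∉ fac e
-apex∉ b x∈ = ℕ.<-irrefl refl (b x∈)

-- A facet of a new layer is told apart from the older facets by its apex, except for the negated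
-- last facet of the ball, which is told apart by the previous pair of apices.
Crowned : ℕ → Facet → Set
Crowned k e = p (4 + k) ∈ upp e ⊎ (m (3 + k) ∷ m (2 + k) ∷ []) ⊆ upp e

crowned-sound : ∀ {k} s {i} → i ≤ k →
                T ((P K 4 ∈ₛ upp s) ∨ ((N K 3 ∷ N K 2 ∷ []) ⊆ₛ upp s)) → Crowned k (inst s i k)
crowned-sound {k} s {i} _ a rewrite upp-inst s i k =
  map-⊎ (∈ₛ-sound (P K 4) (upp s) {i}) (⊆ₛ-sound (N K 3 ∷ N K 2 ∷ []) (upp s) {i})
        (∨⁻ {P K 4 ∈ₛ upp s} a)

new-crowned : ∀ {k e} → e ∈ blk newF k → Crowned k e
new-crowned {k} = blk-All (λ s → (P K 4 ∈ₛ upp s) ∨ ((N K 3 ∷ N K 2 ∷ []) ⊆ₛ upp s)) crowned-sound newF tt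

-- The counterpart of the second alternative in `Crowned`: the two largest labels occur together
-- with equal sign only in facets of the ball and its negative.
Sparse : ℕ → Facet → Set
Sparse k e = Misses (p (3 + k) ∷ p (2 + k) ∷ []) (fac e) × Misses (m (3 + k) ∷ m (2 + k) ∷ []) (fac e)

sparseₛ : Num → Shape → Bool
sparseₛ (b , c) s = misses same (P b (suc c) ∷ P b c ∷ []) (fac s)
                  ∧ misses same (N b (suc c) ∷ N b c ∷ []) (fac s)

sparse-sound : ∀ x {k} s {i} → i ≤ k → T (sparseₛ x s) →
               Misses (p (suc (num x i k)) ∷ p (num x i k) ∷ []) (fac (inst s i k)) ×
               Misses (m (suc (num x i k)) ∷ m (num x i k) ∷ []) (fac (inst s i k))
sparse-sound (b , c) {k} s {i} i≤k a rewrite fac-inst s i k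
  with ∧⁻ {misses same (P b (suc c) ∷ P b c ∷ []) (fac s)} a
... | x , y = misses-sound same (P b (suc c) ∷ P b c ∷ []) (fac s) refl i≤k i≤k x
            , misses-sound same (N b (suc c) ∷ N b c ∷ []) (fac s) refl i≤k i≤k y

outer-sparse : ∀ k {e} → e ∈ outer k → Sparse k e
outer-sparse zero = blk-All {Sparse 0} (sparseₛ (O , 2)) (sparse-sound (O , 2) {0}) coreF tt
outer-sparse (suc k) e∈ with ∈-++⁻ (collar k) e∈
... | inj₁ e∈collar = blk-All (sparseₛ (K , 3)) (sparse-sound (K , 3)) collarF tt e∈collar
-- Facets older than the collar do not reach the new label, which is the first entry of either pair.
... | inj₂ e∈outer = here (apex∉ (outer-bounded k e∈outer)) , here (-apex∉ (outer-bounded k e∈outer))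

rim-single : ∀ {k e} → e ∈ rim k → ∃ λ v → upp e ≡ [ v ]
rim-single {k} = blk-All (λ s → length (upp s) ≡ᵇ 1) single rimF tt
  where
  single : ∀ s {i} → i ≤ k → T (length (upp s) ≡ᵇ 1) → ∃ λ v → upp (inst s i k) ≡ [ v ]
  single s {i} _ a with upp s | upp-inst s i k
  ... | v ∷ [] | eq = at i k v , eq

nextBall⁺ : ∀ {k e} → e ∈ ball (suc k) → e ∈ blk nextBallF k
nextBall⁺ {k} e∈ with ∈-blk⁻ {ballF} e∈
... | _ , here refl , _ , z≤n , refl = ∈-blk⁺ {nextBallF} {one} {next T₃} (here refl) z≤n
... | _ , there (here refl) , i , i≤ , refl with ℕ.m≤n⇒m<n∨m≡n i≤
...   | inj₁ (s≤s i≤k) =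
  subst (_∈ blk nextBallF k) (inst-subst (I , 0) (K , 1) T₂ i k) (∈-blk⁺ {nextBallF} {down} (there (there (here refl))) i≤k)
...   | inj₂ refl = ∈-blk⁺ {nextBallF} {one} {last T₂} (there (here refl)) z≤n
nextBall⁺ {k} e∈ | _ , there (there (here refl)) , i , i≤ , refl with ℕ.m≤n⇒m<n∨m≡n i≤
... | inj₁ (s≤s i≤k) =
  subst (_∈ blk nextBallF k) (inst-subst (I , 0) (K , 1) T₁ i k) (∈-blk⁺ {nextBallF} {up} (there (there (there (here refl)))) i≤k)
... | inj₂ refl = ∈-blk⁺ {nextBallF} {one} {last T₁} (there (there (there (there (here refl))))) z≤n
nextBall⁺ {k} e∈ | _ , there (there (there (here refl))) , _ , z≤n , refl =
  ∈-blk⁺ {nextBallF} {one} {next T₄} (there (there (there (there (there (here refl)))))) z≤n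
nextBall⁺ {k} e∈ | _ , there (there (there (there (here refl)))) , _ , z≤n , refl =
  ∈-blk⁺ {nextBallF} {one} {next T₅} (there (there (there (there (there (there (here refl))))))) z≤n

nextBall⁻ : ∀ {k e} → e ∈ blk nextBallF k → e ∈ ball (suc k)
nextBall⁻ {k} e∈ with ∈-blk⁻ {nextBallF} e∈
... | _ , here refl , _ , z≤n , refl = ∈-blk⁺ {ballF} {one} {T₃} (here refl) z≤n
... | _ , there (here refl) , _ , z≤n , refl =
  ∈-blk⁺ {ballF} {down} {T₂} {suc k} (there (here refl)) ℕ.≤-refl
... | _ , there (there (here refl)) , i , i≤k , refl =
  ∈-blk⁺ {ballF} {down} {T₂} {i} (there (here refl)) (ℕ.m≤n⇒m≤1+n i≤k)
... | _ , there (there (there (here refl))) , i , i≤k , refl =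
  ∈-blk⁺ {ballF} {up} {T₁} {i} (there (there (here refl))) (ℕ.m≤n⇒m≤1+n i≤k)
... | _ , there (there (there (there (here refl)))) , _ , z≤n , refl =
  ∈-blk⁺ {ballF} {up} {T₁} {suc k} (there (there (here refl))) ℕ.≤-refl
... | _ , there (there (there (there (there (here refl))))) , _ , z≤n , refl =
  ∈-blk⁺ {ballF} {one} {T₄} (there (there (there (here refl)))) z≤n
... | _ , there (there (there (there (there (there (here refl)))))) , _ , z≤n , refl =
  ∈-blk⁺ {ballF} {one} {T₅} (there (there (there (there (here refl))))) z≤n

blk-++ : ∀ fs gs k → blk (fs ++ gs) k ≡ blk fs k ++ blk gs k
blk-++ fs gs k = concatMap-++ (enum k) fs gs

new : ℕ → List Facet
new k = blk newF k

new⁺ : ∀ {k e} → e ∈ ball (suc k) ⊎ e ∈ collar k → e ∈ new k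
new⁺ {k} {e} e∈ = subst (e ∈_) (sym (blk-++ nextBallF collarF k))
  ([ ∈-++⁺ˡ ∘ nextBall⁺ , ∈-++⁺ʳ (blk nextBallF k) ]′ e∈)

half⁻ : ∀ {k e} → e ∈ half (suc k) → e ∈ new k ⊎ e ∈ outer k
half⁻ {k} e∈ with ∈-++⁻ (ball (suc k)) e∈
... | inj₁ e∈ball = inj₁ (new⁺ (inj₁ e∈ball))
... | inj₂ e∈′ with ∈-++⁻ (collar k) e∈′
...   | inj₁ e∈collar = inj₁ (new⁺ (inj₂ e∈collar))
...   | inj₂ e∈outer = inj₂ e∈outer

new⊆half : ∀ {k e} → e ∈ new k → e ∈ half (suc k)
new⊆half {k} {e} e∈ with ∈-++⁻ (blk nextBallF k) (subst (e ∈_) (blk-++ nextBallF collarF k) e∈)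
... | inj₁ e∈ball = ∈-++⁺ˡ (nextBall⁻ e∈ball)
... | inj₂ e∈collar = ∈-++⁺ʳ (ball (suc k)) (∈-++⁺ˡ e∈collar)

outer⊆half : ∀ {k e} → e ∈ outer k → e ∈ half (suc k)
outer⊆half {k} e∈ = ∈-++⁺ʳ (ball (suc k)) (∈-++⁺ʳ (collar k) e∈)

-- The order conditions, and the second facet through each ridge

-- For k = 0 the families of the ball shrink to single facets. Replacing `I` and `K` by 0 turns all
-- labels into constants, so that they become comparable with those of the core; `blk baseF 0`
-- reduces to `half 0`.
baseF : List Family
baseF = map (λ (_ , s) → one , substS (O , 0) (O , 0) s) ballF ++ coreF

apex≢ : ∀ {k e x} → Bounded (4 + k) e → x ∈ fac e → x ≢ apex k
apex≢ b x∈ refl = apex∉ b x∈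

AllPairs-++⁻ : ∀ {A : Set} {_~_ : A → A → Set} xs {ys} → AllPairs _~_ (xs ++ ys) →
               AllPairs _~_ ys × (∀ {x y} → x ∈ xs → y ∈ ys → x ~ y)
AllPairs-++⁻ [] ord = ord , λ ()
AllPairs-++⁻ (x ∷ xs) (x~ ∷ ord) with AllPairs-++⁻ xs ord
... | ord′ , xs~ys = ord′ , λ { (here refl) y∈ → All.lookup x~ (∈-++⁺ʳ xs y∈)
                              ; (there x∈)  y∈ → xs~ys x∈ y∈ }

AllPairs-reverse⁺ : ∀ {A : Set} {_~_ : A → A → Set} {xs} → AllPairs _~_ xs →
                    AllPairs (flip _~_) (reverse xs)
AllPairs-reverse⁺ [] = []
AllPairs-reverse⁺ {_~_ = _~_} {x ∷ xs} (x~ ∷ ord) =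
  subst (AllPairs (flip _~_)) (sym (unfold-reverse x xs))
    (AllPairs.++⁺ (AllPairs-reverse⁺ ord) ([] ∷ [])
      (All.tabulate λ y∈ → All.lookup x~ (Any.reverse⁻ y∈) ∷ []))

module _ {k e f} (e∈ : e ∈ new k) (f∈ : f ∈ outer k) where

  private
    bf = outer-bounded k f∈

    p-pair : Misses (p (3 + k) ∷ p (2 + k) ∷ []) (fac f)
    p-pair = proj₁ (outer-sparse k f∈)

    m-pair : Misses (m (3 + k) ∷ m (2 + k) ∷ []) (fac f)
    m-pair = proj₂ (outer-sparse k f∈)

  new-upp-misses-outer : Misses (upp e) (fac f) × Misses (upp e) (negF (fac f))
  new-upp-misses-outer with new-crowned e∈
  ... | inj₁ a∈ = lose a∈ (apex∉ bf) , lose a∈ (-apex∉ bf ∘ ∈-neg⁻)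
  ... | inj₂ mm⊆ = Misses-antitone mm⊆ m-pair , Misses-antitone mm⊆ (Misses-neg p-pair)

  -- Deleting its apex pushes e into the ball it was erected on.
  outer-misses-new : ∀ {R} → R ⊆ fac f → (∀ {t} → t ∈ ball k → Misses R (fac t)) → Misses R (fac e)
  outer-misses-new {R} R⊆f R-ball with new-beneath e∈
  ... | t , t∈ , e-t with find (R-ball t∈)
  ...   | x , x∈ , x∉t = lose x∈ x∉e
    where
    x∉e : x ∉ fac e
    x∉e x∈e with e-t x∈e
    ... | inj₁ (inj₁ refl) = apex∉ bf (R⊆f x∈)
    ... | inj₁ (inj₂ refl) = -apex∉ bf (R⊆f x∈)
    ... | inj₂ x∈t = x∉t x∈t

  outer-misses-neg-new : ∀ {R} → R ⊆ fac f → (∀ {t} → t ∈ ball k → Misses R (negF (fac t))) →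
                         Misses R (negF (fac e))
  outer-misses-neg-new {R} R⊆f R-ball with new-beneath e∈
  ... | t , t∈ , e-t with find (R-ball t∈)
  ...   | x , x∈ , x∉t = lose x∈ x∉e
    where
    x∉e : x ∉ negF (fac e)
    x∉e x∈e with e-t (∈-neg⁻ x∈e)
    ... | inj₁ (inj₁ eq) = -apex∉ bf (R⊆f (subst (_∈ R) (trans (sym (neg-involutive x)) (cong ℤ.-_ eq)) x∈))
    ... | inj₁ (inj₂ eq) = apex∉ bf (R⊆f (subst (_∈ R) (neg-injective eq) x∈))
    ... | inj₂ x∈t = x∉t (subst (_∈ negF (fac t)) (neg-involutive x) (∈-neg⁺ x∈t))

half-ordered : ∀ k → AllPairs _≺_ (half k)
half-ordered zero = pairwise-sound ≺-test baseF 0 tt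
half-ordered (suc k) =
  AllPairs.++⁺ (ball-ordered (suc k))
    (AllPairs.++⁺ (collar-ordered k) (proj₁ older)
      (All.tabulate λ e∈ → All.tabulate λ f∈ → new≺outer (new⁺ (inj₂ e∈)) f∈))
    (All.tabulate λ e∈ → All.tabulate λ f∈ → ball≺ e∈ f∈)
  where
  older : AllPairs _≺_ (outer k) × (∀ {t f} → t ∈ ball k → f ∈ outer k → t ≺ f)
  older = AllPairs-++⁻ (ball k) (half-ordered k)
  new≺outer : ∀ {e f} → e ∈ new k → f ∈ outer k → e ≺ f
  new≺outer {e} {f} e∈ f∈ =
    outer-misses-new e∈ f∈ (low⊆fac f) (λ t∈ → proj₁ (proj₂ older t∈ f∈)) ,
    proj₁ (new-upp-misses-outer e∈ f∈)
  ball≺ : ∀ {e f} → e ∈ ball (suc k) → f ∈ collar k ++ outer k → e ≺ f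
  ball≺ e∈ f∈ with ∈-++⁻ (collar k) f∈
  ... | inj₁ f∈collar = nextBall≺collar (nextBall⁺ e∈) f∈collar
  ... | inj₂ f∈outer = new≺outer (new⁺ (inj₁ e∈)) f∈outer

half-against : ∀ k {e f} → e ∈ half k → f ∈ half k → Against e f
half-against zero {e} {f} = across-sound against-test baseF baseF {0} {e} {f} tt
half-against (suc k) {e} {f} e∈ f∈ with half⁻ e∈ | half⁻ f∈
... | inj₁ e∈new   | inj₁ f∈new   = new-against e∈new f∈new
... | inj₁ e∈new   | inj₂ f∈outer = proj₂ (new-upp-misses-outer e∈new f∈outer)
... | inj₂ e∈outer | inj₁ f∈new   =
  outer-misses-neg-new f∈new e∈outer (upp⊆fac e)
    (λ t∈ → half-against k (∈-++⁺ʳ (ball k) e∈outer) (∈-++⁺ˡ t∈))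
... | inj₂ e∈outer | inj₂ f∈outer =
  half-against k (∈-++⁺ʳ (ball k) e∈outer) (∈-++⁺ʳ (ball k) f∈outer)

half-tetra : ∀ k {e} → e ∈ half k → Tetra (fac e)
half-tetra zero {e} e∈ = blk-All {Tetra ∘ fac} tetraₛ (tetra-sound {0}) baseF tt {e} e∈
half-tetra (suc k) e∈ with half⁻ e∈
... | inj₁ e∈new = new-tetra e∈new
... | inj₂ e∈outer = half-tetra k (∈-++⁺ʳ (ball k) e∈outer)

whole : ℕ → List Facet
whole k = half k ++ reverse (map negT (half k))

whole⁺ : ∀ {k e} → e ∈ half k → e ∈ whole k
whole⁺ = ∈-++⁺ˡ

whole⁻⁺ : ∀ {k e} → e ∈ half k → negT e ∈ whole k
whole⁻⁺ {k} e∈ = ∈-++⁺ʳ (half k) (Any.reverse⁺ (∈-map⁺ negT e∈))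

whole⁻ : ∀ {k e} → e ∈ whole k → e ∈ half k ⊎ ∃ λ f → f ∈ half k × e ≡ negT f
whole⁻ {k} e∈ = map-⊎ id (∈-map⁻ negT ∘ Any.reverse⁻) (∈-++⁻ (half k) e∈)

-- Since `low (negT f)` is the negative of `upp f`, both components are instances of `Against`, with
-- the two facets in either role.
≺-opposite : ∀ {k e f} → e ∈ half k → f ∈ half k → e ≺ negT f
≺-opposite {k} {e} {f} e∈ f∈ rewrite low-neg f | fac-neg f =
  subst (Misses _) (negF-involutive (fac e)) (Misses-neg (half-against k f∈ e∈)) , half-against k e∈ f∈

whole-ordered : ∀ k → AllPairs _≺_ (whole k)
whole-ordered k = AllPairs.++⁺ (half-ordered k)
  (AllPairs-reverse⁺ (AllPairs.map⁺ (AllPairs.map ≺-neg (half-ordered k))))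
  (All.tabulate λ e∈ → All.tabulate λ f∈ → lem e∈ (∈-map⁻ negT (Any.reverse⁻ f∈)))
  where
  lem : ∀ {e f} → e ∈ half k → (∃ λ g → g ∈ half k × f ≡ negT g) → e ≺ f
  lem e∈ (g , g∈ , refl) = ≺-opposite e∈ g∈

tetra-neg : ∀ {F} → Tetra F → Tetra (negF F)
tetra-neg {F} (u , l) =
  AllPairs.map⁺ (AllPairs.map (λ x≢y → x≢y ∘ neg-injective) u) , trans (length-map _ F) l

whole-tetra : ∀ k {e} → e ∈ whole k → Tetra (fac e)
whole-tetra k e∈ with whole⁻ {k} e∈
... | inj₁ e∈half = half-tetra k e∈half
... | inj₂ (f , f∈ , refl) = subst Tetra (sym (fac-neg f)) (tetra-neg (half-tetra k f∈))

half≢neg : ∀ {k e f} → e ∈ half k → f ∈ half k → e ≢ negT f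
half≢neg {k} {e} e∈ f∈ eq = ≺⇒⊈ {e} (≺-opposite {k} e∈ f∈) (subst (λ x → fac e ⊆ fac x) eq id)

outer∉ball : ∀ {k e} → e ∈ outer k → e ∉ ball k
outer∉ball {k} {e} e∈ e∈′ = ≺⇒⊈ {e} (proj₂ (AllPairs-++⁻ (ball k) (half-ordered k)) e∈′ e∈) id

-- The second facet through each ridge

cone : ℕ → Facet → Face
cone k t = apex k ∷ low t

rim-bounded : ∀ {k t} → t ∈ rim k → Bounded (4 + k) t
rim-bounded {k} t∈ with rim⇒ball t∈
... | b , b∈ , eq = ball-bounded {k} b∈ ∘ subst (_ ∈_) eq

module _ {k e f v} (e∈ : e ∈ whole k) (e∉ : e ∉ ball k) (f∈ : f ∈ ball k) (v∈ : v ∈ fac e)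
         (e-f : Adj v (fac e) (fac f)) where

  -- The common ridge lies on the boundary of the ball, as no third facet contains it.
  cross-rim : ∃ λ t → t ∈ rim k × Adj v (fac e) (cone k t)
  cross-rim with whole-tetra k e∈ | half-tetra k (∈-++⁺ˡ f∈)
  ... | ue , |e| | uf , |f| with Adj-sym ue uf (trans |e| (sym |f|)) v∈ e-f
  ...   | w , w∈ , f-e with classify f∈ w∈
  ...     | t , t∈ , inj₁ f-t with rim⇒ball t∈
  ...       | g , g∈ , eq rewrite eq =
    ⊥-elim (e∉ (subst (_∈ ball k) (sym (ridge-in-two (comparable (whole-ordered k)) (whole-tetra k)
      (whole⁺ (∈-++⁺ˡ f∈)) e∈ (whole⁺ (∈-++⁺ˡ g∈)) w∈ f-e f-t)) g∈))
  cross-rim | _ | uf , _ | w , w∈ , f-e | t , t∈ , inj₂ (t≡f , upp≡w) = t , t∈ , v∉ , ⊆cone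
    where
    v∉ : v ∉ cone k t
    v∉ (here refl) = whole-apex∉ e∈ v∈
      where
      whole-apex∉ : ∀ {e} → e ∈ whole k → apex k ∉ fac e
      whole-apex∉ e∈ with whole⁻ {k} e∈
      ... | inj₁ e∈half = apex∉ (half-bounded k e∈half)
      ... | inj₂ (g , g∈ , refl) = -apex∉ (half-bounded k g∈) ∘ ∈-neg⁻ ∘ subst (_ ∈_) (fac-neg g)
    v∉ (there v∈t) = proj₁ e-f (subst (v ∈_) t≡f (low⊆fac t v∈t))
    ⊆cone : ∀ {x} → x ∈ fac e → x ≢ v → x ∈ cone k t
    ⊆cone {x} x∈ x≢v with low⊎upp t (subst (x ∈_) (sym t≡f) (proj₂ e-f x∈ x≢v))
    ... | inj₁ x∈low = there x∈low
    ... | inj₂ x∈upp with subst (x ∈_) upp≡w x∈upp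
    ...   | here refl = ⊥-elim (proj₁ f-e x∈)

-- Allowing either sign keeps the induction on the half: the facets of its negative and the
-- exchanged facet need no separate treatment.
Neighbour : ℕ → ℤ → Face → Set
Neighbour k v F = ∃ λ f → f ∈ half k × (Adj v F (fac f) ⊎ Adj v F (negF (fac f)))

neighbour-neg : ∀ {k v F} → Neighbour k v F → Neighbour k (ℤ.- v) (negF F)
neighbour-neg (f , f∈ , inj₁ adj) = f , f∈ , inj₂ (Adj-neg adj)
neighbour-neg {v = v} {F} (f , f∈ , inj₂ adj) =
  f , f∈ , inj₁ (subst (Adj (ℤ.- v) (negF F)) (negF-involutive (fac f)) (Adj-neg adj))

neighbour-neg⁻ : ∀ {k v F} → Neighbour k (ℤ.- v) (negF F) → Neighbour k v F
neighbour-neg⁻ {k} {v} {F} nb =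
  subst (λ v → Neighbour k v F) (neg-involutive v)
    (subst (Neighbour k (ℤ.- (ℤ.- v))) (negF-involutive F) (neighbour-neg nb))

neighbour-⊆ : ∀ {k v F G} → F ⊆ G → Neighbour k v G → Neighbour k v F
neighbour-⊆ F⊆G (f , f∈ , adj) =
  f , f∈ , map-⊎ (Adj-resp F⊆G ≋-refl) (Adj-resp F⊆G ≋-refl) adj

cone-neighbour : ∀ {k v F t} → t ∈ rim k → Adj v F (cone k t) → Neighbour (suc k) v F
cone-neighbour t∈ adj with rim-cone t∈
... | f , f∈ , t≋f = f , new⊆half f∈ ,
  map-⊎ (λ t≋ → Adj-resp id t≋ adj) (λ t≋ → Adj-resp id t≋ adj) t≋f

cone-neighbour-neg : ∀ {k v F t} → t ∈ rim k → Adj v F (negF (cone k t)) → Neighbour (suc k) v F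
cone-neighbour-neg {k} {v} {F} {t} t∈ adj = neighbour-neg⁻ (cone-neighbour {v = ℤ.- v} {negF F} {t} t∈
  (subst (Adj (ℤ.- v) (negF F)) (negF-involutive (cone k t)) (Adj-neg adj)))

module _ {k e f v} (e∈ : e ∈ half k) (f∈ : f ∈ ball k) (v∈ : v ∈ fac e) where

  private
    −e∈ : negT e ∈ whole k
    −e∈ = whole⁻⁺ e∈

  -- This is `cross-rim` for -e, negated back; -e is outside the ball because the half and its
  -- negative have no facet in common.
  cross-rim-neg : Adj v (fac e) (negF (fac f)) → ∃ λ t → t ∈ rim k × Adj v (fac e) (negF (cone k t))
  cross-rim-neg adj with cross-rim −e∈ (λ −e∈ball → half≢neg {k} (∈-++⁺ˡ −e∈ball) e∈ refl) f∈
    (subst (_ ∈_) (sym (fac-neg e)) (∈-neg⁺ v∈))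
    (subst₂ (Adj (ℤ.- v)) (sym (fac-neg e)) (negF-involutive (fac f)) (Adj-neg adj))
  ... | t , t∈ , e-t = t , t∈ , subst (λ v → Adj v (fac e) (negF (cone k t))) (neg-involutive v)
    (subst (λ F → Adj (ℤ.- (ℤ.- v)) F (negF (cone k t)))
      (trans (cong negF (fac-neg e)) (negF-involutive (fac e))) (Adj-neg e-t))

-- Across a ridge through the apex lies the cone over the adjacent boundary triangle. Across the
-- base lies the old facet on the other side, unless that facet is removed with -B; the base is then
-- also a boundary triangle of -B, and the cone over it with the negated apex is the neighbour.
cone-closed : ∀ {k t v} → (∀ {e v} → e ∈ half k → v ∈ fac e → Neighbour k v (fac e)) →
              t ∈ rim k → v ∈ cone k t → Neighbour (suc k) v (cone k t)
cone-closed {k} {t} closed t∈ (there v∈) with rim-closed t∈ v∈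
... | t′ , t′∈ , (v∉ , ⊆t′) = cone-neighbour t′∈
  ( (λ { (here v≡) → apex≢ (rim-bounded t∈) (low⊆fac t v∈) v≡ ; (there v∈t′) → v∉ v∈t′ })
  , λ { (here x≡) _ → here x≡ ; (there x∈) x≢v → there (⊆t′ x∈ x≢v) })
cone-closed {k} {t} closed t∈ (here refl) with rim⇒ball t∈ | rim-single t∈
... | b , b∈ , t≡b | y , upp≡y = base (closed (∈-++⁺ˡ b∈) y∈b)
  where
  y∈upp : y ∈ upp t
  y∈upp = subst (y ∈_) (sym upp≡y) (here refl)
  y∈b : y ∈ fac b
  y∈b = subst (y ∈_) t≡b (upp⊆fac t y∈upp)
  ut : Unique (fac t)
  ut = subst Unique (sym t≡b) (proj₁ (ball-tetra b∈))
  low⊆ : ∀ {F} → Adj y (fac b) F → low t ⊆ F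
  low⊆ (_ , ⊆F) x∈ = ⊆F (subst (_ ∈_) t≡b (low⊆fac t x∈)) λ { refl → low∩upp t ut x∈ y∈upp }
  over : ∀ {F} → apex k ∉ F → Adj y (fac b) F → Adj (apex k) (cone k t) F
  over a∉F adj = a∉F , λ { (here x≡a) x≢a → ⊥-elim (x≢a x≡a) ; (there x∈) _ → low⊆ adj x∈ }
  from-outer : ∀ {f} → Adj y (fac b) (fac f) ⊎ Adj y (fac b) (negF (fac f)) → f ∈ outer k →
               Neighbour (suc k) (apex k) (cone k t)
  from-outer {f} adj f∈ = f , outer⊆half f∈ ,
    map-⊎ (over (apex∉ (outer-bounded k f∈))) (over (-apex∉ (outer-bounded k f∈) ∘ ∈-neg⁻)) adj
  not-in-ball : ∀ {f} → Adj y (fac b) (fac f) → OnlyIn t f → ⊥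
  not-in-ball adj (inj₁ mis) = Misses⇒⊈ mis (low⊆ adj)
  not-in-ball adj (inj₂ t≡f) = proj₁ adj (subst (y ∈_) t≡f (upp⊆fac t y∈upp))
  apex∉-cone : ∀ {t′} → t′ ∈ rim k → apex k ∉ negF (cone k t′)
  apex∉-cone {t′} t′∈ a∈ with ∈-neg⁻ {F = cone k t′} a∈
  ... | there a∈t′ = -apex∉ (rim-bounded t′∈) (low⊆fac t′ a∈t′)
  from-ball : ∀ {f} → Adj y (fac b) (fac f) ⊎ Adj y (fac b) (negF (fac f)) → f ∈ ball k →
              Neighbour (suc k) (apex k) (cone k t)
  from-ball (inj₁ adj) f∈ = ⊥-elim (not-in-ball adj (rim-only t∈ f∈))
  from-ball (inj₂ adj) f∈ =
    let t′ , t′∈ , b-t′ = cross-rim-neg (∈-++⁺ˡ b∈) f∈ y∈b adj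
    in cone-neighbour-neg {t = t′} t′∈ (over (apex∉-cone t′∈) b-t′)
  base : Neighbour k y (fac b) → Neighbour (suc k) (apex k) (cone k t)
  base (f , f∈ , adj) = [ from-ball adj , from-outer adj ]′ (∈-++⁻ (ball k) f∈)

-- An old facet keeps its old neighbour, or finds the cone over the common ridge where the neighbour
-- was removed. A new facet is a cone up to sign.
half-closed : ∀ k {e v} → e ∈ half k → v ∈ fac e → Neighbour k v (fac e)
half-closed zero e∈ v∈ = covers-marked-sound adj±-hit fac fac-inst baseF baseF {0} tt e∈ v∈
half-closed (suc k) {e} {v} e∈ v∈ with half⁻ e∈
... | inj₂ e∈outer = across-ridge (half-closed k e∈half v∈)
  where
  e∈half : e ∈ half k
  e∈half = ∈-++⁺ʳ (ball k) e∈outer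
  from-ball : ∀ {f} → Adj v (fac e) (fac f) ⊎ Adj v (fac e) (negF (fac f)) → f ∈ ball k →
              Neighbour (suc k) v (fac e)
  from-ball (inj₁ adj) f∈ =
    let t , t∈ , e-t = cross-rim (whole⁺ e∈half) (outer∉ball e∈outer) f∈ v∈ adj
    in cone-neighbour {t = t} t∈ e-t
  from-ball (inj₂ adj) f∈ =
    let t , t∈ , e-t = cross-rim-neg e∈half f∈ v∈ adj
    in cone-neighbour-neg {t = t} t∈ e-t
  across-ridge : Neighbour k v (fac e) → Neighbour (suc k) v (fac e)
  across-ridge (f , f∈ , adj) =
    [ from-ball adj , (λ f∈outer → f , outer⊆half f∈outer , adj) ]′ (∈-++⁻ (ball k) f∈)
... | inj₁ e∈new with new-cone e∈new
...   | t , t∈ , inj₁ t≋e =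
  neighbour-⊆ (proj₂ t≋e) (cone-closed (half-closed k) t∈ (proj₂ t≋e v∈))
...   | t , t∈ , inj₂ t≋−e = neighbour-neg⁻
  (neighbour-⊆ (proj₂ t≋−e) (cone-closed (half-closed k) t∈ (proj₂ t≋−e (∈-neg⁺ v∈))))

neighbour⇒whole : ∀ {k v F} → Neighbour k v F → ∃ λ f → f ∈ whole k × Adj v F (fac f)
neighbour⇒whole (f , f∈ , inj₁ adj) = f , whole⁺ f∈ , adj
neighbour⇒whole {v = v} {F} (f , f∈ , inj₂ adj) =
  negT f , whole⁻⁺ f∈ , subst (Adj v F) (sym (fac-neg f)) adj

whole-closed : ∀ k → Closed (whole k)
whole-closed k e∈ v∈ with whole⁻ {k} e∈
... | inj₁ e∈half = neighbour⇒whole (half-closed k e∈half v∈)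
... | inj₂ (g , g∈ , refl) = neighbour⇒whole (subst (Neighbour k _) (sym (fac-neg g))
        (neighbour-neg⁻ (subst (Neighbour k _) (sym (negF-involutive (fac g)))
          (half-closed k g∈ (∈-neg⁻ {F = fac g} (subst (_ ∈_) (fac-neg g) v∈))))))

-- The complexes Del 3 n

⊆ᵇ⇒⊆ : ∀ F G → T (F ⊆ᵇ G) → F ⊆ G
⊆ᵇ⇒⊆ F G t x∈ = Any.map toWitness (Any.any⁻ _ G (All.lookup (All.all⁺ _ F t) x∈))

⊆⇒⊆ᵇ : ∀ {F G} → F ⊆ G → T (F ⊆ᵇ G)
⊆⇒⊆ᵇ F⊆G = All.all⁻ _ (All.tabulate λ x∈ → Any.any⁺ _ (Any.map fromWitness (F⊆G x∈)))

T-not⁺ : ∀ {b} → ¬ T b → T (not b)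
T-not⁺ {true}  ¬t = ¬t tt
T-not⁺ {false} _  = tt

T-not⁻ : ∀ {b} → T (not b) → ¬ T b
T-not⁻ {false} _ ()

∈-minus⁺ : ∀ {Δ Γ F} → F ∈ Δ → (∀ {G} → G ∈ Γ → ¬ (F ⊆ G)) → F ∈ minus Δ Γ
∈-minus⁺ {Γ = Γ} {F} F∈ F⊈ = ∈-filter⁺ (T? ∘ _) F∈
  (T-not⁺ λ t → let G , G∈ , s = find (Any.any⁻ _ Γ t) in F⊈ G∈ (⊆ᵇ⇒⊆ F G s))

∈-minus⁻ : ∀ {Δ Γ F} → F ∈ minus Δ Γ → F ∈ Δ × (∀ {G} → G ∈ Γ → ¬ (F ⊆ G))
∈-minus⁻ {Δ} {Γ} {F} F∈ with ∈-filter⁻ (T? ∘ λ F → not (any (λ G → F ⊆ᵇ G) Γ)) {xs = Δ} F∈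
... | F∈Δ , t = F∈Δ , λ G∈ F⊆G → T-not⁻ {any (λ G → F ⊆ᵇ G) Γ} t (Any.any⁺ _ (lose G∈ (⊆⇒⊆ᵇ F⊆G)))

module _ {X : Complex} where

  private
    holders : Face → List Face
    holders R = filterᵇ (λ G → R ⊆ᵇ G) X

  boundary⁻ : ∀ {R} → R ∈ boundary X → ∃₂ λ F v →
              F ∈ X × v ∈ F × R ≡ F ∖ v × (∀ {G} → G ∈ X → R ⊆ G → G ≡ F)
  boundary⁻ {R} R∈ with find (∈-concatMap⁻ _ {xs = X} R∈)
  ... | F , F∈ , R∈F with ∈-filter⁻ (T? ∘ λ R → length (holders R) ≡ᵇ 1) {xs = map (F ∖_) F} R∈F
  ...   | R∈map , one-holder with ∈-map⁻ (F ∖_) R∈map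
  ...     | v , v∈ , refl = F , v , F∈ , v∈ , refl , λ G∈ ⊆G →
    single (holders (F ∖ v)) one-holder (holds G∈ ⊆G) (holds F∈ (proj₁ ∘ ∈-∖⁻ {F}))
    where
    holds : ∀ {G} → G ∈ X → (F ∖ v) ⊆ G → G ∈ holders (F ∖ v)
    holds G∈ ⊆G = ∈-filter⁺ (T? ∘ _) G∈ (⊆⇒⊆ᵇ ⊆G)
    single : ∀ (ys : List Face) {a b} → T (length ys ≡ᵇ 1) → a ∈ ys → b ∈ ys → a ≡ b
    single (_ ∷ []) _ (here refl) (here refl) = refl

  -- `boundary` counts entries of a list, so a repeated generator would make an outer ridge look
  -- shared; hence `Unique X`.
  boundary⁺ : ∀ {F v} → Unique X → F ∈ X → v ∈ F →
              (∀ {G} → G ∈ X → (F ∖ v) ⊆ G → G ≡ F) → (F ∖ v) ∈ boundary X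
  boundary⁺ {F} {v} uX F∈ v∈ only = ∈-concatMap⁺ _ (lose F∈
    (∈-filter⁺ (T? ∘ λ R → length (holders R) ≡ᵇ 1) (∈-map⁺ (F ∖_) v∈)
      (single (holders (F ∖ v)) (AllPairs.filter⁺ (T? ∘ _) uX)
        (∈-filter⁺ (T? ∘ _) F∈ (⊆⇒⊆ᵇ (proj₁ ∘ ∈-∖⁻ {F})))
        (λ G∈ → let G∈X , s = ∈-filter⁻ (T? ∘ λ G → (F ∖ v) ⊆ᵇ G) {xs = X} G∈ in
          only G∈X (⊆ᵇ⇒⊆ (F ∖ v) _ s)))))
    where
    single : ∀ (ys : List Face) → Unique ys → F ∈ ys → (∀ {G} → G ∈ ys → G ≡ F) → T (length ys ≡ᵇ 1)
    single (_ ∷ []) _ _ _ = tt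
    single (y ∷ z ∷ _) ((y≢z ∷ _) ∷ _) _ all≡ =
      ⊥-elim (y≢z (trans (all≡ (here refl)) (sym (all≡ (there (here refl))))))

negF-injective : ∀ {F G} → negF F ≡ negF G → F ≡ G
negF-injective {F} {G} eq = trans (sym (negF-involutive F)) (trans (cong negF eq) (negF-involutive G))

negC-unique : ∀ {X} → Unique X → Unique (negC X)
negC-unique uX = AllPairs.map⁺ (AllPairs.map (λ F≢G → F≢G ∘ negF-injective) uX)

boundary-neg : ∀ {X R} → Unique X → R ∈ boundary (negC X) → ∃ λ S → S ∈ boundary X × S ≋ negF R
boundary-neg {X} uX R∈ with boundary⁻ {negC X} R∈
... | F , v , F∈ , v∈ , refl , only with ∈-map⁻ negF F∈
...   | F′ , F′∈ , refl = F′ ∖ (ℤ.- v)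
  , boundary⁺ uX F′∈ (∈-neg⁻ v∈) (λ {G} G∈ ⊆G → negF-injective (only (∈-map⁺ negF G∈) (to ⊆G)))
  , fro , to′
  where
  to : ∀ {G} → (F′ ∖ (ℤ.- v)) ⊆ G → (negF F′ ∖ v) ⊆ negF G
  to {G} ⊆G {x} x∈ with ∈-∖⁻ {negF F′} x∈
  ... | x∈F , x≢v = subst (_∈ negF G) (neg-involutive x)
    (∈-neg⁺ (⊆G (∈-∖⁺ (∈-neg⁻ x∈F) (x≢v ∘ neg-injective))))
  to′ : negF (negF F′ ∖ v) ⊆ (F′ ∖ (ℤ.- v))
  to′ {x} x∈ = subst (x ∈_) (negF-involutive _) (negF-⊆ (to id) x∈)
  fro : (F′ ∖ (ℤ.- v)) ⊆ negF (negF F′ ∖ v)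
  fro {x} x∈ with ∈-∖⁻ {F′} x∈
  ... | x∈F , x≢ = subst (_∈ negF (negF F′ ∖ v)) (neg-involutive x)
    (∈-neg⁺ (∈-∖⁺ (∈-neg⁺ x∈F) λ eq → x≢ (trans (sym (neg-involutive x)) (cong ℤ.-_ eq))))

negC-involutive : ∀ X → negC (negC X) ≡ X
negC-involutive X = trans (sym (map-∘ X)) (trans (map-cong negF-involutive X) (map-id X))

boundary-neg⁻ : ∀ {X R} → Unique X → R ∈ boundary X → ∃ λ S → S ∈ boundary (negC X) × S ≋ negF R
boundary-neg⁻ {X} {R} uX R∈ =
  boundary-neg {negC X} (negC-unique uX) (subst (λ Y → R ∈ boundary Y) (sym (negC-involutive X)) R∈)

module _ {D B : Complex} {n : ℕ} where

  private
    D₀ D₊ : Complex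
    D₀ = minus D (B ++ negC B)
    D₊ = joinV (boundary B) (ℤ.+ suc n)

  step-old⁺ : ∀ {F} → F ∈ minus D (B ++ negC B) → F ∈ step D B n
  step-old⁺ = ∈-++⁺ˡ

  step-up⁺ : ∀ {R} → R ∈ boundary B → (p n ∷ R) ∈ step D B n
  step-up⁺ R∈ = ∈-++⁺ʳ D₀ (∈-++⁺ˡ (∈-map⁺ (p n ∷_) R∈))

  step-down⁺ : ∀ {R} → R ∈ boundary (negC B) → (m n ∷ R) ∈ step D B n
  step-down⁺ R∈ = ∈-++⁺ʳ D₀ (∈-++⁺ʳ D₊ (∈-map⁺ (m n ∷_) R∈))

  step⁻ : ∀ {F} → F ∈ step D B n → F ∈ minus D (B ++ negC B) ⊎
          (∃ λ R → R ∈ boundary B × F ≡ p n ∷ R) ⊎ (∃ λ R → R ∈ boundary (negC B) × F ≡ m n ∷ R)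
  step⁻ F∈ with ∈-++⁻ D₀ F∈
  ... | inj₁ F∈D₀ = inj₁ F∈D₀
  ... | inj₂ F∈′ = inj₂ (map-⊎ (∈-map⁻ (p n ∷_)) (∈-map⁻ (m n ∷_)) (∈-++⁻ D₊ F∈′))

-- The ball unfolded from its recursive definition

edges : (ℕ → ℤ) → ℕ → Complex
edges f n = applyUpTo (λ i → f i ∷ f (suc i) ∷ []) n

pathEdges-applyUpTo : ∀ f n y ys → pathEdges (applyUpTo f (suc n) ++ y ∷ ys) ≡
                      edges f n ++ (f n ∷ y ∷ []) ∷ pathEdges (y ∷ ys)
pathEdges-applyUpTo f zero    y ys = refl
pathEdges-applyUpTo f (suc n) y ys = cong (_ ∷_) (pathEdges-applyUpTo (f ∘ suc) n y ys)

cycle1-edges : ∀ n → cycle1 (suc n) ≡ edges p n ++ (p n ∷ m 0 ∷ []) ∷ edges m n ++ (m n ∷ p 0 ∷ []) ∷ []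
cycle1-edges n = begin
  cycle1 (suc n)
    ≡⟨ cong₂ (λ xs ys → pathEdges (xs ++ ys ++ [ p 0 ])) (map-upTo p (suc n)) (map-upTo m (suc n)) ⟩
  pathEdges (applyUpTo p (suc n) ++ applyUpTo m (suc n) ++ [ p 0 ])
    ≡⟨ pathEdges-applyUpTo p n (m 0) (applyUpTo (m ∘ suc) n ++ [ p 0 ]) ⟩
  edges p n ++ (p n ∷ m 0 ∷ []) ∷ pathEdges (applyUpTo m (suc n) ++ [ p 0 ])
    ≡⟨ cong (λ es → edges p n ++ (p n ∷ m 0 ∷ []) ∷ es) (pathEdges-applyUpTo m n (p 0) []) ⟩
  edges p n ++ (p n ∷ m 0 ∷ []) ∷ edges m n ++ (m n ∷ p 0 ∷ []) ∷ [] ∎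
  where open ≡-Reasoning

-- The cycle meets the removed edge only in its own edge from n + 2 to -1, which it lists with the
-- endpoints in the other order; every other edge has an endpoint off it.
Bl₁ : ∀ n → Bl 1 (2 + n) 1 ≡ edges p (suc n) ++ edges m (suc n) ++ (m (suc n) ∷ p 0 ∷ []) ∷ []
Bl₁ n = begin
  filterᵇ keep (cycle1 (2 + n))
    ≡⟨ cong (filterᵇ keep) (cycle1-edges (suc n)) ⟩
  filterᵇ keep (edges p (suc n) ++ (p (suc n) ∷ m 0 ∷ []) ∷ edges m (suc n) ++ (m (suc n) ∷ p 0 ∷ []) ∷ [])
    ≡⟨ filter-++ (T? ∘ keep) (edges p (suc n)) _ ⟩
  filterᵇ keep (edges p (suc n)) ++
  filterᵇ keep ((p (suc n) ∷ m 0 ∷ []) ∷ edges m (suc n) ++ (m (suc n) ∷ p 0 ∷ []) ∷ [])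
    ≡⟨ cong₂ _++_ filter-p filter-m ⟩
  edges p (suc n) ++ edges m (suc n) ++ (m (suc n) ∷ p 0 ∷ []) ∷ [] ∎
  where
  open ≡-Reasoning
  chord : Face
  chord = m 0 ∷ p (suc n) ∷ []
  keep : Face → Bool
  keep F = not (any (λ G → F ⊆ᵇ G) [ chord ])
  kept : ∀ F {x} → x ∈ F → x ∉ chord → T (keep F)
  kept F x∈ x∉ = T-not⁺ λ t → case Any.any⁻ (F ⊆ᵇ_) [ chord ] t of λ { (here s) → x∉ (⊆ᵇ⇒⊆ F chord s x∈) }
  kept-p : ∀ {i} → i < suc n → T (keep (p i ∷ p (suc i) ∷ []))
  kept-p {i} i<n = kept (p i ∷ p (suc i) ∷ []) (here refl)
    λ { (there (here eq)) → ℕ.<-irrefl (ℕ.suc-injective (ℤP.+-injective eq)) i<n }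
  kept-m : ∀ i → T (keep (m i ∷ m (suc i) ∷ []))
  kept-m i = kept (m i ∷ m (suc i) ∷ []) (there (here refl)) λ { (here ()) ; (there (here ())) }
  kept-last : T (keep (m (suc n) ∷ p 0 ∷ []))
  kept-last = kept (m (suc n) ∷ p 0 ∷ []) (there (here refl)) λ { (there (here ())) }
  removed : ¬ T (keep (p (suc n) ∷ m 0 ∷ []))
  removed t = T-not⁻ {any ((p (suc n) ∷ m 0 ∷ []) ⊆ᵇ_) [ chord ]} t
    (Any.any⁺ {xs = [ chord ]} ((p (suc n) ∷ m 0 ∷ []) ⊆ᵇ_) (here (⊆⇒⊆ᵇ {p (suc n) ∷ m 0 ∷ []} {chord}
      λ { (here refl) → there (here refl) ; (there (here refl)) → here refl })))
  filter-p : filterᵇ keep (edges p (suc n)) ≡ edges p (suc n)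
  filter-p = filter-all (T? ∘ keep) (All.applyUpTo⁺₁ (λ i → p i ∷ p (suc i) ∷ []) (suc n) kept-p)
  rest : Complex
  rest = edges m (suc n) ++ (m (suc n) ∷ p 0 ∷ []) ∷ []
  filter-m : filterᵇ keep ((p (suc n) ∷ m 0 ∷ []) ∷ rest) ≡ rest
  filter-m = trans (filter-reject (T? ∘ keep) {p (suc n) ∷ m 0 ∷ []} {rest} removed)
    (filter-all (T? ∘ keep) {rest} (All.++⁺ (All.applyUpTo⁺₁ (λ i → m i ∷ m (suc i) ∷ []) (suc n) λ {i} _ → kept-m i) (kept-last ∷ [])))

-- Two nested join clauses: `f` and `g` prepend the cone vertices, while `us` and `vs` are the
-- summands coming from the negated balls of lower index.
map²-++ : ∀ {A : Set} (f g : A → A) xs ys z us vs →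
          map f (map g (xs ++ ys ++ z ∷ []) ++ us) ++ vs ≡
          map (f ∘ g) xs ++ map (f ∘ g) ys ++ f (g z) ∷ map f us ++ vs
map²-++ f g []       []       z us vs = refl
map²-++ f g []       (y ∷ ys) z us vs = cong (f (g y) ∷_) (map²-++ f g [] ys z us vs)
map²-++ f g (x ∷ xs) ys       z us vs = cong (f (g x) ∷_) (map²-++ f g xs ys z us vs)

applyUpTo-cong : ∀ {A : Set} {f g : ℕ → A} → (∀ i → f i ≡ g i) → ∀ n → applyUpTo f n ≡ applyUpTo g n
applyUpTo-cong f≡g zero    = refl
applyUpTo-cong f≡g (suc n) = cong₂ _∷_ (f≡g 0) (applyUpTo-cong (f≡g ∘ suc) n)

Bl₃ : ∀ k → Bl 3 (4 + k) 1 ≡ map fac (blk ballF′ k)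
Bl₃ k = begin
  Bl 3 (4 + k) 1
    ≡⟨ cong (λ E → joinV (joinV E (p (2 + k)) ++ U) (p (3 + k)) ++ V) (Bl₁ k) ⟩
  joinV (joinV (edges p (suc k) ++ edges m (suc k) ++ (m (suc k) ∷ p 0 ∷ []) ∷ []) (p (2 + k)) ++ U) (p (3 + k)) ++ V
    ≡⟨ map²-++ (p (3 + k) ∷_) (p (2 + k) ∷_) (edges p (suc k)) (edges m (suc k)) _ U V ⟩
  map wedge (edges p (suc k)) ++ map wedge (edges m (suc k)) ++ W
    ≡⟨ cong₂ (λ xs ys → xs ++ ys ++ W) (family p T₁ λ _ → refl) (family m T₂ λ _ → refl) ⟩
  map fac (enum k (up , T₁)) ++ map fac (enum k (up , T₂)) ++ W
    ≡⟨ cong (map fac (enum k (up , T₁)) ++_) (map-++ fac (enum k (up , T₂)) W′) ⟨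
  map fac (enum k (up , T₁)) ++ map fac (enum k (up , T₂) ++ W′)
    ≡⟨ map-++ fac (enum k (up , T₁)) (enum k (up , T₂) ++ W′) ⟨
  map fac (blk ballF′ k) ∎
  where
  open ≡-Reasoning
  U V W : Complex
  W′ : List Facet
  U = (m (2 + k) ∷ p 0 ∷ m (suc k) ∷ []) ∷ []
  V = (m (3 + k) ∷ m (2 + k) ∷ p 0 ∷ m (suc k) ∷ []) ∷ []
  W = map fac W′
  W′ = inst T₃ 0 k ∷ inst T₄ 0 k ∷ inst T₅ 0 k ∷ []
  wedge : Face → Face
  wedge F = p (3 + k) ∷ p (2 + k) ∷ F
  family : ∀ f s → (∀ i → wedge (f i ∷ f (suc i) ∷ []) ≡ fac (inst s i k)) →
           map wedge (edges f (suc k)) ≡ map fac (enum k (up , s))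
  family f s eq = trans (map-applyUpTo (λ i → f i ∷ f (suc i) ∷ []) wedge (suc k))
    (trans (applyUpTo-cong eq (suc k)) (sym (map-applyUpTo (λ i → inst s i k) fac (suc k))))

∷-≋ : ∀ {x F G} → F ≋ G → (x ∷ F) ≋ (x ∷ G)
∷-≋ (p , q) = (λ { (here eq) → here eq ; (there x∈) → there (p x∈) })
            , (λ { (here eq) → here eq ; (there x∈) → there (q x∈) })

low≋∖ : ∀ {t v} → Unique (fac t) → upp t ≡ [ v ] → low t ≋ (fac t ∖ v)
low≋∖ {t} {v} u upp≡ =
  (λ x∈ → ∈-∖⁺ (low⊆fac t x∈) λ { refl → low∩upp t u x∈ (subst (v ∈_) (sym upp≡) (here refl)) }) , back
  where
  back : (fac t ∖ v) ⊆ low t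
  back {x} x∈ with ∈-∖⁻ {fac t} x∈
  ... | x∈t , x≢v with low⊎upp t x∈t
  ...   | inj₁ x∈low = x∈low
  ...   | inj₂ x∈upp with subst (x ∈_) upp≡ x∈upp
  ...     | here x≡v = ⊥-elim (x≢v x≡v)

-- Facets are matched up to list equality and not only as sets, because `boundary⁺` identifies the
-- generator holding a ridge as a list.
record IsBall (k : ℕ) (B : Complex) : Set where
  field
    B⁺       : ∀ {b} → b ∈ ball k → fac b ∈ B
    B⁻       : ∀ {F} → F ∈ B → ∃ λ b → b ∈ ball k × F ≡ fac b
    B-unique : Unique B

Bl-isBall : ∀ k → IsBall k (Bl 3 (4 + k) 1)
Bl-isBall k = subst (IsBall k) (sym (Bl₃ k)) record
  { B⁺ = λ b∈ → let b′ , b′∈ , eq = ball⇒ball′ {k} b∈ in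
      subst (_∈ map fac (blk ballF′ k)) (sym eq) (∈-map⁺ fac b′∈)
  ; B⁻ = λ F∈ → let b′ , b′∈ , F≡ = ∈-map⁻ fac {xs = blk ballF′ k} F∈
                    b  , b∈  , eq = ball′⇒ball {k} b′∈
                in b , b∈ , trans F≡ eq
  ; B-unique = AllPairs.map⁺ (AllPairs.map (λ mis eq → Misses⇒⊈ mis (subst (_ ∈_) eq)) (ball′-distinct k)) }

-- One step of the recursion for the sphere

module _ (k : ℕ) {B D : Complex} (isBall : IsBall k B) (rep : Represents (whole k) D) where

  open IsBall isBall

  -- If `classify` found a facet across the ridge, that facet would be a second generator holding
  -- it, against the count in `boundary`.
  boundary⇒rim : ∀ {R} → R ∈ boundary B → ∃ λ t → t ∈ rim k × R ≋ low t
  boundary⇒rim R∈ with boundary⁻ {B} R∈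
  ... | F , v , F∈ , v∈ , refl , only with B⁻ F∈
  ...   | b , b∈ , refl with classify b∈ v∈
  ...     | t , t∈ , inj₂ (t≡b , upp≡) = t , t∈ , ≋-sym (subst (λ F → low t ≋ (F ∖ v)) t≡b
              (low≋∖ {t} (subst Unique (sym t≡b) (proj₁ (ball-tetra b∈))) upp≡))
  ...     | t , t∈ , inj₁ (v∉t , ⊆t) with rim⇒ball t∈
  ...       | g , g∈ , t≡g = ⊥-elim (v∉t (subst (v ∈_) (sym (only t∈B ∖⊆t)) v∈))
    where
    t∈B : fac t ∈ B
    t∈B = subst (_∈ B) (sym t≡g) (B⁺ g∈)
    ∖⊆t : (fac b ∖ v) ⊆ fac t
    ∖⊆t x∈ = let x∈b , x≢v = ∈-∖⁻ {fac b} x∈ in ⊆t x∈b x≢v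

  rim⇒boundary : ∀ {t} → t ∈ rim k → ∃ λ R → R ∈ boundary B × R ≋ low t
  rim⇒boundary {t} t∈ with rim⇒ball t∈ | rim-single t∈
  ... | b , b∈ , t≡b | v , upp≡ = fac t ∖ v
    , boundary⁺ B-unique (subst (_∈ B) (sym t≡b) (B⁺ b∈)) v∈ only
    , ≋-sym low≋
    where
    v∈ : v ∈ fac t
    v∈ = upp⊆fac t (subst (v ∈_) (sym upp≡) (here refl))
    low≋ : low t ≋ (fac t ∖ v)
    low≋ = low≋∖ {t} (subst Unique (sym t≡b) (proj₁ (ball-tetra b∈))) upp≡
    only : ∀ {G} → G ∈ B → (fac t ∖ v) ⊆ G → G ≡ fac t
    only G∈ ⊆G with B⁻ G∈
    ... | g , g∈ , refl with rim-only t∈ g∈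
    ...   | inj₁ mis = ⊥-elim (Misses⇒⊈ mis (⊆G ∘ proj₁ low≋))
    ...   | inj₂ t≡g = sym t≡g

  private
    Δ : Complex
    Δ = step D B (4 + k)

  cone⁺ : ∀ {t} → t ∈ rim k → ∃ λ F → F ∈ Δ × F ≋ cone k t
  cone⁺ {t} t∈ =
    let R , R∈ , R≋ = rim⇒boundary {t} t∈
    in apex k ∷ R , step-up⁺ {D} {B} {4 + k} {R} R∈ , ∷-≋ {apex k} {R} {low t} R≋

  cone⁻ : ∀ {t} → t ∈ rim k → ∃ λ F → F ∈ Δ × F ≋ negF (cone k t)
  cone⁻ {t} t∈ =
    let R , R∈ , R≋ = rim⇒boundary {t} t∈
        S , S∈ , S≋ = boundary-neg⁻ {B} {R} B-unique R∈
    in m (4 + k) ∷ S , step-down⁺ {D} {B} {4 + k} {S} S∈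
     , ∷-≋ {m (4 + k)} {S} {negF (low t)} (≋-trans {S} {negF R} {negF (low t)} S≋ (negF-≋ {R} {low t} R≋))

  cone⇒whole : ∀ {t} → t ∈ rim k →
               (∃ λ e → e ∈ whole (suc k) × cone k t ≋ fac e) ×
               (∃ λ e → e ∈ whole (suc k) × negF (cone k t) ≋ fac e)
  cone⇒whole {t} t∈ with rim-cone t∈
  ... | f , f∈ , inj₁ t≋ = (f , whole⁺ (new⊆half f∈) , t≋)
    , (negT f , whole⁻⁺ (new⊆half f∈) , ≋-trans (negF-≋ t≋) (≡⇒≋ (sym (fac-neg f))))
  ... | f , f∈ , inj₂ t≋ = (negT f , whole⁻⁺ (new⊆half f∈) , ≋-trans t≋ (≡⇒≋ (sym (fac-neg f))))
    , (f , whole⁺ (new⊆half f∈) , ≋-trans (negF-≋ t≋) (≡⇒≋ (negF-involutive (fac f))))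

  ±B⁻ : ∀ {G} → G ∈ B ++ negC B → ∃ λ b → b ∈ ball k × (G ≡ fac b ⊎ G ≡ negF (fac b))
  ±B⁻ G∈ with ∈-++⁻ B G∈
  ... | inj₁ G∈B with B⁻ G∈B
  ...   | b , b∈ , eq = b , b∈ , inj₁ eq
  ±B⁻ G∈ | inj₂ G∈−B with ∈-map⁻ negF G∈−B
  ... | F , F∈ , refl with B⁻ F∈
  ...   | b , b∈ , refl = b , b∈ , inj₂ refl

  old⇒whole : ∀ {F} → F ∈ minus D (B ++ negC B) → ∃ λ e → e ∈ whole (suc k) × F ≋ fac e
  old⇒whole {F} F∈ with ∈-minus⁻ {D} {B ++ negC B} F∈
  ... | F∈D , F⊈ with proj₁ rep F∈D
  ...   | e , e∈ , F≋e with whole⁻ {k} e∈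
  ...     | inj₁ e∈half =
    [ (λ e∈ball → ⊥-elim (F⊈ (∈-++⁺ˡ (B⁺ e∈ball)) (proj₁ F≋e)))
    , (λ e∈outer → e , whole⁺ (outer⊆half e∈outer) , F≋e) ]′ (∈-++⁻ (ball k) e∈half)
  ...     | inj₂ (f , f∈half , refl) =
    [ (λ f∈ball → ⊥-elim (F⊈ (∈-++⁺ʳ B (∈-map⁺ negF (B⁺ f∈ball)))
                              (subst (F ⊆_) (fac-neg f) (proj₁ F≋e))))
    , (λ f∈outer → negT f , whole⁻⁺ (outer⊆half f∈outer) , F≋e) ]′ (∈-++⁻ (ball k) f∈half)

  Del⇒whole : ∀ {F} → F ∈ Δ → ∃ λ e → e ∈ whole (suc k) × F ≋ fac e
  Del⇒whole F∈ with step⁻ {D} {B} {4 + k} F∈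
  ... | inj₁ F∈old = old⇒whole F∈old
  ... | inj₂ (inj₁ (R , R∈ , refl)) =
    let t , t∈ , R≋ = boundary⇒rim R∈
        e , e∈ , t≋e = proj₁ (cone⇒whole t∈)
    in e , e∈ , ≋-trans (∷-≋ R≋) t≋e
  ... | inj₂ (inj₂ (R , R∈ , refl)) =
    let S , S∈ , S≋ = boundary-neg {B} B-unique R∈
        t , t∈ , S≋t = boundary⇒rim S∈
        e , e∈ , t≋e = proj₂ (cone⇒whole t∈)
    in e , e∈ , ≋-trans (∷-≋ (≋-trans (≡⇒≋ (sym (negF-involutive R))) (negF-≋ (≋-trans (≋-sym S≋) S≋t)))) t≋e

  -- `minus` deletes whatever is contained in a generator. Distinct facets of the ordered list are
  -- incomparable, so only the facets of the ball and its negative are deleted.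
  keep : ∀ {e} → e ∈ whole k → (∀ {b} → b ∈ ball k → e ≢ b × e ≢ negT b) →
         ∃ λ F → F ∈ Δ × F ≋ fac e
  keep {e} e∈ e≢ with proj₂ rep e∈
  ... | F , F∈ , F≋e = F , step-old⁺ {D} {B} {4 + k} (∈-minus⁺ F∈ F⊈) , F≋e
    where
    e⊈ : ∀ {f} → f ∈ whole k → e ≢ f → ¬ (F ⊆ fac f)
    e⊈ f∈ e≢f F⊆f = e≢f (⊆⇒≡ (comparable (whole-ordered k)) e∈ f∈ (F⊆f ∘ proj₂ F≋e))
    F⊈ : ∀ {G} → G ∈ B ++ negC B → ¬ (F ⊆ G)
    F⊈ G∈ with ±B⁻ G∈
    ... | b , b∈ , inj₁ refl = e⊈ (whole⁺ (∈-++⁺ˡ b∈)) (proj₁ (e≢ b∈))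
    ... | b , b∈ , inj₂ refl =
      e⊈ (whole⁻⁺ (∈-++⁺ˡ b∈)) (proj₂ (e≢ b∈)) ∘ subst (F ⊆_) (sym (fac-neg b))

  half⇒Del : ∀ {e} → e ∈ half (suc k) →
             (∃ λ F → F ∈ Δ × F ≋ fac e) × (∃ λ F → F ∈ Δ × F ≋ negF (fac e))
  half⇒Del {e} e∈ with half⁻ e∈
  half⇒Del {e} e∈ | inj₁ e∈new with new-cone e∈new
  ... | t , t∈ , inj₁ t≋ =
    let F , F∈ , F≋ = cone⁺ t∈
        G , G∈ , G≋ = cone⁻ t∈
    in (F , F∈ , ≋-trans F≋ t≋) , (G , G∈ , ≋-trans G≋ (negF-≋ t≋))
  ... | t , t∈ , inj₂ t≋ =
    let F , F∈ , F≋ = cone⁺ t∈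
        G , G∈ , G≋ = cone⁻ t∈
    in (G , G∈ , ≋-trans G≋ (≋-trans (negF-≋ t≋) (≡⇒≋ (negF-involutive (fac e)))))
     , (F , F∈ , ≋-trans F≋ t≋)
  half⇒Del {e} e∈ | inj₂ e∈outer =
      keep (whole⁺ e∈half) (λ {b} b∈ →
        (λ e≡b → outer∉ball e∈outer (subst (_∈ ball k) (sym e≡b) b∈)) ,
        half≢neg {k} e∈half (∈-++⁺ˡ b∈))
    , subst (λ G → ∃ λ F → F ∈ Δ × F ≋ G) (fac-neg e) (keep (whole⁻⁺ e∈half) (λ {b} b∈ →
        (λ −e≡b → half≢neg {k} (∈-++⁺ˡ b∈) e∈half (sym −e≡b)) ,
        (λ −e≡−b → outer∉ball e∈outer (subst (_∈ ball k)
          (trans (sym (negT-involutive b)) (trans (cong negT (sym −e≡−b)) (negT-involutive e))) b∈))))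
    where
    e∈half : e ∈ half k
    e∈half = ∈-++⁺ʳ (ball k) e∈outer

  represents-suc : Represents (whole (suc k)) Δ
  represents-suc = Del⇒whole , whole⇒Del
    where
    whole⇒Del : ∀ {e} → e ∈ whole (suc k) → ∃ λ F → F ∈ Δ × F ≋ fac e
    whole⇒Del e∈ with whole⁻ {suc k} e∈
    ... | inj₁ e∈half = proj₁ (half⇒Del e∈half)
    ... | inj₂ (f , f∈ , refl) =
      subst (λ G → ∃ λ F → F ∈ Δ × F ≋ G) (sym (fac-neg f)) (proj₂ (half⇒Del f∈))

listedᵇ : List Face → List Face → Bool
listedᵇ Γ Δ = all (λ F → any (λ G → (F ⊆ᵇ G) ∧ (G ⊆ᵇ F)) Δ) Γ

listedᵇ-sound : ∀ Γ Δ → T (listedᵇ Γ Δ) → ∀ {F} → F ∈ Γ → ∃ λ G → G ∈ Δ × F ≋ G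
listedᵇ-sound Γ Δ t {F} F∈ with find (Any.any⁻ _ Δ (All.lookup (All.all⁺ _ Γ t) F∈))
... | G , G∈ , s = let F⊆G , G⊆F = ∧⁻ {F ⊆ᵇ G} s in G , G∈ , ⊆ᵇ⇒⊆ F G F⊆G , ⊆ᵇ⇒⊆ G F G⊆F

represents : ∀ k → Represents (whole k) (Del 3 (4 + k))
represents zero = to , from
  where
  to : ∀ {F} → F ∈ Del 3 4 → ∃ λ e → e ∈ whole 0 × F ≋ fac e
  -- The 16 facets for n = 4 are compared with the list by evaluation.
  to F∈ = let G , G∈ , F≋G = listedᵇ-sound (Del 3 4) (map fac (whole 0)) tt F∈
              e , e∈ , G≡  = ∈-map⁻ fac {xs = whole 0} G∈
          in e , e∈ , ≋-trans F≋G (≡⇒≋ G≡)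
  from : ∀ {e} → e ∈ whole 0 → ∃ λ F → F ∈ Del 3 4 × F ≋ fac e
  from e∈ = let F , F∈ , e≋F = listedᵇ-sound (map fac (whole 0)) (Del 3 4) tt (∈-map⁺ fac {xs = whole 0} e∈)
            in F , F∈ , ≋-sym e≋F
represents (suc k) = represents-suc k (Bl-isBall k) (represents k)

map-fac-whole : ∀ k → map fac (whole k) ≡ map fac (half k) ++ reverse (map negF (map fac (half k)))
map-fac-whole k = trans (map-++ fac (half k) (reverse (map negT (half k)))) (cong (map fac (half k) ++_)
  (trans (reverse-map fac (map negT (half k))) (cong reverse
    (trans (sym (map-∘ (half k))) (trans (map-cong fac-neg (half k)) (map-∘ (half k)))))))

theorem8p1 : (n : ℕ) → 4 ≤ n →
    ∃ λ (Fs : List Face) → IsShellingOrder 3 (Del 3 n) (Fs ++ reverse (map negF Fs))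
theorem8p1 _ (s≤s (s≤s (s≤s (s≤s (z≤n {k}))))) = map fac (half k) ,
  subst (IsShellingOrder 3 (Del 3 (4 + k))) (map-fac-whole k)
    (shelling (whole-ordered k) (λ {e} → whole-tetra k {e}) (whole-closed k) (represents k))
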